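{- Let $G$ be a maximal outerplanar graph. Then $G$ has a planar flat visibility representation of height at most $2\,bd^{\mathit{free}}(G)+1$.
   Context: A maximal outerplanar graph is a simple graph $G$ with $n\ge 3$ vertices having a planar embedding (the standard embedding) in which all vertices lie on the outer face and form an $n$-cycle, and all interior faces are triangles. An edge $(u,v)$ of $G$ is a cutting edge if $G-\{u,v\}$ is disconnected, and a non-cutting edge otherwise. For a cutting edge $(u,v)$ there are exactly two cut-components: maximal outerplanar subgraphs $G_1,G_2$ with $G_1\cap G_2=\{u,v\}$ (the edge $(u,v)$) and $G_1\cup G_2=G$. The dual tree of $G$ has a node for each interior face of the standard embedding, two nodes being adjacent iff the faces share an edge. An outerplanar path is a maximal outerplanar graph whose dual tree is a path $f_1,\dots,f_k$; it connects edges $e,e'$ if $e$ is incident to $f_1$ and $e'$ to $f_k$ (a triangle connects any two of its edges). Bonnet: for a non-cutting edge $(u,v)$ of $G$, a bonnet with cap $(u,v)$ is a subgraph $U$ of $G$ with at least 3 vertices that is the union of three outerplanar paths $P$ (the ribbon), $F_1$, $F_2$ (the fans, which may be empty) such that: (1') $P$ connects two non-cutting edges of $G$ and contains $u$, $v$ and their common neighbour; (2) $F_1$ contains only $u$ and neighbours of $u$, and $F_2$ contains only $v$ and neighbours of $v$; (3) $F_1,F_2$ are edge-disjoint, $F_1$ and $P$ have exactly one edge in common (incident to $u$), and $F_2$ and $P$ have exactly one edge in common (incident to $v$); (4) all neighbours of $u$ and $v$ in $G$ belong to $U$. An anchor-edge of $U$ is an edge of $U$ that is a cutting edge of $G$ but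 not of $U$; the hanging subgraph $S_{a,b}$ at anchor-edge $(a,b)$ is the cut-component of $G$ with respect to $(a,b)$ not containing $(u,v)$. A bonnet system of $G$ with root-edge $(u,v)$ (a non-cutting edge) consists of a bonnet $U_0$ in $G$ with cap $(u,v)$ with anchor-edges $(u_i,v_i)$, $i=1,\dots,k$ ($k\ge 0$), and, for each $i$, a bonnet system $\mathcal U_i$ of the hanging subgraph $S_i$ (itself maximal outerplanar) with root-edge $(u_i,v_i)$. Its depth is $1+\max_i d(\mathcal U_i)$ (the maximum over an empty set being $0$). $bd(G;u,v)$ is the minimum depth of a bonnet system of $G$ with root-edge $(u,v)$, and $bd^{\mathit{free}}(G)$ is the minimum of $bd(G;u,v)$ over all non-cutting edges $(u,v)$. A flat visibility representation represents each vertex by a horizontal line segment and each edge by a horizontal or vertical line segment joining the segments of its endpoints; it is planar if no two elements intersect unless the corresponding graph elements are incident. All segment endpoints have integer $y$-coordinates; a layer is a horizontal line with integer $y$-coordinate meeting the drawing, and the height is the number of layers. -}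

module Defs where

open import Data.Nat using (ℕ; zero; suc; _∸_) renaming (_≤_ to _≤ℕ_; _<_ to _<ℕ_)
open import Data.Fin using (Fin; toℕ; fromℕ) renaming (zero to fzero)
open import Data.Bool using (Bool; true; false; _∧_; _∨_; if_then_else_)
open import Data.Integer using (ℤ; _≤_; _<_; _⊓_; _⊔_)
open import Data.Product using (Σ; _×_; _,_; ∃; ∃-syntax)
open import Data.Sum using (_⊎_)
open import Data.Empty using (⊥)
open import Data.List using (List; length)
open import Data.List.Membership.Propositional using (_∈_)
open import Relation.Nullary using (¬_)
open import Relation.Binary.PropositionalEquality using (_≡_; _≢_)
open import Function.Bundles using (_⇔_)

-- Graphs whose vertices form a subset of Fin N (so that subgraphs,
-- cut-components etc. live in the same ambient vertex type).

record Graph (N : ℕ) : Set where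
  field
    V : Fin N → Bool
    E : Fin N → Fin N → Bool
open Graph public

module _ {N : ℕ} where

  _∈V_ : Fin N → Graph N → Set
  x ∈V G = V G x ≡ true

  Adj : Graph N → Fin N → Fin N → Set
  Adj G x y = E G x y ≡ true

  Simple : Graph N → Set
  Simple G = (∀ x y → Adj G x y → Adj G y x)
           × (∀ x → ¬ Adj G x x)
           × (∀ x y → Adj G x y → x ∈V G × y ∈V G)

  SubG : Graph N → Graph N → Set
  SubG H G = (∀ x → x ∈V H → x ∈V G) × (∀ x y → Adj H x y → Adj G x y)

  EmptyG : Graph N → Set
  EmptyG H = (∀ x → V H x ≡ false) × (∀ x y → E H x y ≡ false)

  union3 : Graph N → Graph N → Graph N → Graph N
  union3 A B C = record { V = λ x → V A x ∨ V B x ∨ V C x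
                        ; E = λ x y → E A x y ∨ E B x y ∨ E C x y }

  -- Maximal outerplanar graphs.  The standard embedding is encoded
  -- combinatorially: an enumeration ord : Fin k → vertices (k ≥ 3) giving
  -- the outer k-cycle in cyclic order; the remaining edges (chords) are
  -- pairwise non-crossing w.r.t. this cyclic order (outerplanarity), and
  -- every interior face is a triangle, i.e. the chords triangulate the
  -- polygon: no further chord can be added without crossing an edge.

  record MOPEmbedding (G : Graph N) (k : ℕ) : Set where
    field
      ord       : Fin k → Fin N
      ord-inj   : ∀ i j → ord i ≡ ord j → i ≡ j
      ord-in    : ∀ i → ord i ∈V G
      ord-onto  : ∀ x → x ∈V G → ∃[ i ] ord i ≡ x
      cyc-step  : ∀ i j → toℕ j ≡ suc (toℕ i) → Adj G (ord i) (ord j)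
      cyc-close : ∀ i j → toℕ i ≡ 0 → toℕ j ≡ k ∸ 1 → Adj G (ord i) (ord j)
      noncross  : ∀ i j l m → toℕ i <ℕ toℕ j → toℕ j <ℕ toℕ l → toℕ l <ℕ toℕ m →
                  ¬ (Adj G (ord i) (ord l) × Adj G (ord j) (ord m))
      triang    : ∀ i l → toℕ i <ℕ toℕ l → ¬ Adj G (ord i) (ord l) →
                  ∃[ j ] ∃[ m ] (toℕ i <ℕ toℕ j × toℕ j <ℕ toℕ l
                               × (toℕ m <ℕ toℕ i ⊎ toℕ l <ℕ toℕ m)
                               × Adj G (ord j) (ord m))

  MaxOuterplanar : Graph N → Set
  MaxOuterplanar G = Simple G × Σ ℕ λ k → 3 ≤ℕ k × MOPEmbedding G k

  InMinus : Graph N → Fin N → Fin N → Fin N → Set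
  InMinus G a b x = x ∈V G × x ≢ a × x ≢ b

  data Reach (G : Graph N) (a b : Fin N) : Fin N → Fin N → Set where
    here : ∀ {x} → InMinus G a b x → Reach G a b x x
    step : ∀ {x y z} → Reach G a b x y → Adj G y z → InMinus G a b z →
           Reach G a b x z

  Cutting : Graph N → Fin N → Fin N → Set
  Cutting G a b = Adj G a b × ∃[ x ] ∃[ y ]
    (InMinus G a b x × InMinus G a b y × ¬ Reach G a b x y)

  NonCutting : Graph N → Fin N → Fin N → Set
  NonCutting G a b = Adj G a b ×
    (∀ x y → InMinus G a b x → InMinus G a b y → Reach G a b x y)

  CutComponent : Graph N → Fin N → Fin N → Graph N → Set
  CutComponent G a b H = ∃[ x₀ ] (InMinus G a b x₀
    × (∀ x → x ∈V H ⇔ (x ≡ a ⊎ x ≡ b ⊎ Reach G a b x₀ x))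
    × (∀ x y → E H x y ≡ (E G x y ∧ V H x ∧ V H y)))

  Tri : Set
  Tri = Fin N × Fin N × Fin N

  _∈T_ : Fin N → Tri → Set
  x ∈T (a , b , c) = x ≡ a ⊎ x ≡ b ⊎ x ≡ c

  IsFace : Graph N → Tri → Set
  IsFace G (a , b , c) = Adj G a b × Adj G b c × Adj G a c

  SameTri : Tri → Tri → Set
  SameTri t s = ∀ x → x ∈T t ⇔ x ∈T s

  ShareEdge : Tri → Tri → Set
  ShareEdge t s = ∃[ x ] ∃[ y ] (x ≢ y × x ∈T t × y ∈T t × x ∈T s × y ∈T s)

  DualPath : Graph N → (m : ℕ) → (Fin (suc m) → Tri) → Set
  DualPath G m f = (∀ i → IsFace G (f i))
    × (∀ t → IsFace G t → ∃[ i ] SameTri t (f i))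
    × (∀ i j → SameTri (f i) (f j) → i ≡ j)
    × (∀ i j → i ≢ j →
         ShareEdge (f i) (f j) ⇔ (toℕ j ≡ suc (toℕ i) ⊎ toℕ i ≡ suc (toℕ j)))

  OPath : Graph N → Set
  OPath G = MaxOuterplanar G × Σ ℕ λ m → Σ (Fin (suc m) → Tri) λ f → DualPath G m f

  EdgeOf : Fin N → Fin N → Tri → Set
  EdgeOf a b t = a ∈T t × b ∈T t

  SameEdge : Fin N → Fin N → Fin N → Fin N → Set
  SameEdge a b c d = (a ≡ c × b ≡ d) ⊎ (a ≡ d × b ≡ c)

  OPathConnects : Graph N → Fin N → Fin N → Fin N → Fin N → Set
  OPathConnects G a b c d = MaxOuterplanar G × Adj G a b × Adj G c d
    × ¬ SameEdge a b c d
    × Σ ℕ λ m → Σ (Fin (suc m) → Tri) λ f → DualPath G m f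
        × EdgeOf a b (f fzero) × EdgeOf c d (f (fromℕ m))

  OneCommonEdgeAt : Graph N → Graph N → Fin N → Set
  OneCommonEdgeAt P F u = ∃[ x ] (Adj P u x × Adj F u x
    × (∀ a b → Adj P a b → Adj F a b → SameEdge a b u x))

  FanAt : Graph N → Graph N → Graph N → Fin N → Set
  FanAt G P F u = EmptyG F
    ⊎ (OPath F × SubG F G × (∀ x → x ∈V F → x ≡ u ⊎ Adj G u x)
       × OneCommonEdgeAt P F u)

  record Bonnet (G : Graph N) (u v : Fin N) : Set where
    field
      P F₁ F₂   : Graph N
      cap-nc    : NonCutting G u v
      P-sub     : SubG P G
      a b c d   : Fin N
      ab-nc     : NonCutting G a b
      cd-nc     : NonCutting G c d
      P-conn    : OPathConnects P a b c d
      u∈P       : u ∈V P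
      v∈P       : v ∈V P
      common∈P  : ∀ w → Adj G u w → Adj G v w → w ∈V P
      fan₁      : FanAt G P F₁ u
      fan₂      : FanAt G P F₂ v
      fans-disj : ∀ x y → ¬ (Adj F₁ x y × Adj F₂ x y)
    U : Graph N
    U = union3 P F₁ F₂
    field
      three     : ∃[ x ] ∃[ y ] ∃[ z ] (x ∈V U × y ∈V U × z ∈V U
                                       × x ≢ y × y ≢ z × x ≢ z)
      nbrs      : ∀ w → (Adj G u w ⊎ Adj G v w) → w ∈V U

  open Bonnet public using (U)

  Anchor : Graph N → Graph N → Fin N → Fin N → Set
  Anchor G U a b = Adj U a b × Cutting G a b × ¬ Cutting U a b

  -- HasBonnetSystem d G u v : G has a bonnet system with root-edge (u,v)
  -- of depth at most d.  The hanging subgraph at an anchor edge (a,b) is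
  -- the cut-component of G w.r.t. (a,b) not containing the edge (u,v).
  HasBonnetSystem : ℕ → Graph N → Fin N → Fin N → Set
  HasBonnetSystem zero    G u v = ⊥
  HasBonnetSystem (suc d) G u v = Σ (Bonnet G u v) λ B →
    ∀ a b → Anchor G (U B) a b →
    ∀ S → CutComponent G a b S → ¬ Adj S u v →
    HasBonnetSystem d S a b

  -- Flat visibility representations.
  -- Vertex v: horizontal segment [l v, r v] × {y v}.
  -- Edge (u,v): horizontal (hor u v = true) along y u = y v between the two
  -- vertex segments, or vertical at x = ex u v between y u and y v.
  -- Every element is an axis-parallel (degenerate) box; two elements
  -- intersect iff their boxes intersect.

  record FlatVisRep (G : Graph N) : Set where
    field
      y l r : Fin N → ℤ
      hor   : Fin N → Fin N → Bool
      ex    : Fin N → Fin N → ℤ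

  record Box : Set where
    constructor box
    field
      x₁ x₂ y₁ y₂ : ℤ

  Meet : Box → Box → Set
  Meet (box a₁ a₂ b₁ b₂) (box c₁ c₂ d₁ d₂) =
    a₁ ≤ c₂ × c₁ ≤ a₂ × b₁ ≤ d₂ × d₁ ≤ b₂

  module _ {G : Graph N} (R : FlatVisRep G) where
    open FlatVisRep R

    vbox : Fin N → Box
    vbox w = box (l w) (r w) (y w) (y w)

    ebox : Fin N → Fin N → Box
    ebox u v = if hor u v
      then box (r u ⊓ r v) (l u ⊔ l v) (y u) (y u)
      else box (ex u v) (ex u v) (y u ⊓ y v) (y u ⊔ y v)

    EdgeOK : Fin N → Fin N → Set
    EdgeOK u v with hor u v
    ... | true  = y u ≡ y v × (r u < l v ⊎ r v < l u)
    ... | false = (l u ≤ ex u v × ex u v ≤ r u) × (l v ≤ ex u v × ex u v ≤ r v)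

    IsPlanarFlatVis : Set
    IsPlanarFlatVis =
        (∀ w → w ∈V G → l w ≤ r w)
      × (∀ u v → hor u v ≡ hor v u) × (∀ u v → ex u v ≡ ex v u)
      × (∀ u v → Adj G u v → EdgeOK u v)
      × (∀ u w → u ∈V G → w ∈V G → u ≢ w → ¬ Meet (vbox u) (vbox w))
      × (∀ w u v → w ∈V G → Adj G u v → w ≢ u → w ≢ v →
           ¬ Meet (vbox w) (ebox u v))
      × (∀ u v a b → Adj G u v → Adj G a b →
           u ≢ a → u ≢ b → v ≢ a → v ≢ b → ¬ Meet (ebox u v) (ebox a b))

    Layer : ℤ → Set
    Layer k = (∃[ w ] (w ∈V G × y w ≡ k))
            ⊎ (∃[ u ] ∃[ v ] (Adj G u v × Box.y₁ (ebox u v) ≤ k × k ≤ Box.y₂ (ebox u v)))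

    HeightAtMost : ℕ → Set
    HeightAtMost h = Σ (List ℤ) λ L → length L ≤ℕ h × (∀ k → Layer k → k ∈ L)

-- A maximal outerplanar graph rooted at an outer edge is a binary tree of triangles, and a bonnet
-- system is turned into a recursive decomposition of that tree: the ribbon is a path through the root
-- triangle down to leaves, the fans are its continuations along the neighbours of u and v, and
-- everything else hangs at anchor-edges.  By induction on the depth d one draws the graph on 2d + 1
-- layers with u in the top left and v in the top right corner: u and v fill the top layer, the
-- neighbours of u and v on the fans and the upper side of the ribbon lie on the second layer, the
-- lower side of the ribbon on the last one, and the hanging drawings of height 2d - 1 are placed
-- between them, upright below the second layer or upside down above the last one.
--
-- A drawing is a grid whose cells are labelled with vertices, each vertex segment and each edge using
-- only cells labelled with the vertex or with an end of the edge; then planarity is automatic, since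
-- two elements that meet share a label.
--
-- The structure of the bonnet is recovered from one connectivity fact: a triangulated polygon stays
-- connected when two non-adjacent vertices are removed.  So a maximal outerplanar subgraph that has
-- vertices on both sides of a chord contains that chord.

module Submission where

open import Defs
open import Data.Nat using (ℕ; zero; suc; z≤n; s≤s; _+_; _*_; _⊓_; _⊔_) renaming (_≤_ to _≤ℕ_; _<_ to _<ℕ_)
import Data.Nat.Properties as ℕ
open import Data.Integer using (ℤ; +_; +≤+; +<+) renaming (_≤_ to _≤ℤ_; _⊔_ to _⊔ℤ_)
import Data.Integer.Properties as ℤ
open import Data.Fin using (Fin; zero; suc; toℕ; fromℕ; fromℕ<; opposite; inject₁)
open import Data.Fin.Properties using (_≟_; toℕ<n; toℕ-injective; toℕ-fromℕ; toℕ-fromℕ<; toℕ-inject₁;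
  opposite-prop; opposite-involutive)
open import Data.Bool using (Bool; true; false; _∧_; _∨_)
open import Data.Bool.Properties using (∨-zeroʳ)
open import Data.Maybe using (Maybe; just; nothing)
open import Data.Maybe.Properties using (just-injective)
open import Data.List using (List; []; _∷_; _++_; map; upTo)
open import Data.List.Properties using (length-map; length-upTo)
open import Data.List.Membership.Propositional using (_∈_)
open import Data.List.Membership.Propositional.Properties using (∈-map⁺; ∈-upTo⁺)
open import Data.List.Relation.Unary.All using (All; []; _∷_)
import Data.List.Relation.Unary.All as All
import Data.List.Relation.Unary.All.Properties as All
open import Data.List.Relation.Unary.Any using (Any; here; there)
import Data.List.Relation.Unary.Any as Any
import Data.List.Relation.Unary.Any.Properties as Any
open import Data.Product using (Σ; _×_; _,_; proj₁; proj₂; ∃-syntax)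
open import Data.Sum using (_⊎_; inj₁; inj₂; [_,_])
import Data.Sum as Sum
open import Data.Empty using (⊥; ⊥-elim)
open import Data.Unit using (⊤; tt)
open import Relation.Nullary using (¬_; Dec; yes; no; does; contradiction)
open import Relation.Nullary.Decidable using (dec-true)
open import Relation.Binary.Definitions using (tri<; tri≈; tri>)
open import Relation.Binary.PropositionalEquality hiding ([_])
open import Function using (_∘_; id; Equivalence; mk⇔)

-- A level costs two rows. Within a side of the bonnet the first row belongs to an end of the cap.
-- An upright hanging drawing starts in the second row and leaves the last row to a vertex passing
-- underneath; an upside-down one ends in the last row and leaves the second row to the upper side
-- of the ribbon, or empty. Either way 2d - 1 rows plus two suffice, and a lone edge takes one row.
-- On the combinatorial side the obstacle is that ribbon and fans come as abstract subgraphs with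
-- triangulations of their own, unrelated to the tree of `G`. They are located by asking, for each
-- subtree, whether the ribbon has a vertex strictly behind its root edge. The dual path supplies
-- three facts: a triangle has at most two neighbours; a ribbon triangle with nothing of the ribbon
-- behind it is an end of the path, where a non-cutting edge of `G` must lie; and the triangles can
-- be walked one after the other across shared edges.

Between : {h : ℕ} → Fin h → Fin h → Fin h → Set
Between i m j = (toℕ i ≤ℕ toℕ m × toℕ m ≤ℕ toℕ j) ⊎ (toℕ j ≤ℕ toℕ m × toℕ m ≤ℕ toℕ i)

-- Neighbouring positions on a path

Next : ∀ {m} → Fin m → Fin m → Set
Next i j = toℕ j ≡ suc (toℕ i) ⊎ toℕ i ≡ suc (toℕ j)

next≢ : ∀ {m} {i j : Fin m} → Next i j → i ≢ j
next≢ (inj₁ e) refl = ℕ.1+n≢n (sym e)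
next≢ (inj₂ e) refl = ℕ.1+n≢n (sym e)

-- Only predecessor and successor qualify, so two of any three coincide. This is what keeps a ribbon
-- from branching.
next-three : ∀ {m} {i j k l : Fin m} → Next i j → Next i k → Next i l → j ≡ k ⊎ j ≡ l ⊎ k ≡ l
next-three {m} {i} {j} {k} {l} = λ where
    (inj₁ p) (inj₁ q) _ → inj₁ (up p q)
    (inj₂ p) (inj₂ q) _ → inj₁ (down p q)
    (inj₁ p) (inj₂ q) (inj₁ r) → inj₂ (inj₁ (up p r))
    (inj₁ p) (inj₂ q) (inj₂ r) → inj₂ (inj₂ (down q r))
    (inj₂ p) (inj₁ q) (inj₁ r) → inj₂ (inj₂ (up q r))
    (inj₂ p) (inj₁ q) (inj₂ r) → inj₂ (inj₁ (down p r))
  where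
  up : ∀ {j k : Fin m} → toℕ j ≡ suc (toℕ i) → toℕ k ≡ suc (toℕ i) → j ≡ k
  up p q = toℕ-injective (trans p (sym q))
  down : ∀ {j k : Fin m} → toℕ i ≡ suc (toℕ j) → toℕ i ≡ suc (toℕ k) → j ≡ k
  down p q = toℕ-injective (ℕ.suc-injective (trans (sym p) q))

-- The walk runs from `i` down to `zero` and then up to `j`, which spares comparing the two.
next-chain : ∀ {m} (Q : Fin (suc m) → Set) → (∀ {i j} → Next i j → Q i → Q j) → ∀ i j → Q i → Q j
next-chain {m} Q st i j q = up (toℕ j) j refl (down (toℕ i) i refl q)
  where
  down : ∀ n i → toℕ i ≡ n → Q i → Q zero
  down n zero _ q = q
  down (suc n) (suc i) e q =
    down n (inject₁ i) (trans (toℕ-inject₁ i) (ℕ.suc-injective e))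
      (st (inj₂ (cong suc (sym (toℕ-inject₁ i)))) q)
  up : ∀ n i → toℕ i ≡ n → Q zero → Q i
  up n zero _ q = q
  up (suc n) (suc i) e q =
    st (inj₁ (cong suc (sym (toℕ-inject₁ i))))
      (up n (inject₁ i) (trans (toℕ-inject₁ i) (ℕ.suc-injective e)) q)

-- The predecessor and the successor of an inner position are two apart, hence not neighbours
-- themselves; `last-face` contradicts exactly this.
end-or-inner : ∀ {m} (i : Fin (suc m)) → i ≡ zero ⊎ i ≡ fromℕ m
  ⊎ ∃[ j ] ∃[ k ] (Next i j × Next i k × j ≢ k × ¬ Next j k)
end-or-inner zero = inj₁ refl
end-or-inner {suc m} (suc i) with toℕ (suc i) ℕ.≟ suc m
... | yes e = inj₂ (inj₁ (toℕ-injective (trans e (sym (toℕ-fromℕ (suc m))))))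
... | no ne = inj₂ (inj₂ (inject₁ i , fromℕ< 2+i<m , inj₂ (cong suc (sym j≡)) , inj₁ k≡ ,
    (λ e → ℕ.<⇒≢ j<k (cong toℕ e)) , λ where
      (inj₁ e) → ℕ.1+n≢n (ℕ.suc-injective (trans (sym k≡) (trans e (cong suc j≡))))
      (inj₂ e) → ℕ.<⇒≢ (ℕ.<-trans j<k (ℕ.n<1+n _)) e))
  where
  2+i<m : suc (suc (toℕ i)) <ℕ suc (suc m)
  2+i<m = s≤s (ℕ.≤∧≢⇒< (toℕ<n i) ne)
  j≡ : toℕ (inject₁ i) ≡ toℕ i
  j≡ = toℕ-inject₁ i
  k≡ : toℕ (fromℕ< 2+i<m) ≡ suc (suc (toℕ i))
  k≡ = toℕ-fromℕ< 2+i<m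
  j<k : toℕ (inject₁ i) <ℕ toℕ (fromℕ< 2+i<m)
  j<k = subst₂ _<ℕ_ (sym j≡) (sym k≡) (ℕ.m≤n⇒m≤1+n ℕ.≤-refl)

-- Trees of triangles

module _ {N : ℕ} where

  private variable
    a b c p u v w x y z : Fin N
    G H : Graph N
    d h h′ : ℕ

  -- A `leaf` is an edge with nothing behind it; `node c` is the triangle on the root edge and `c`,
  -- with the rest of the polygon behind its two other sides. Read from left to right, the vertices
  -- come in outer order.
  data Tree : Fin N → Fin N → Set where
    leaf : Tree a b
    node : ∀ c → Tree a c → Tree c b → Tree a b

  private variable
    L : Tree a c
    R : Tree c b
    t : Tree a b

  data Int (x : Fin N) : Tree a b → Set where
    top : {L : Tree a x} {R : Tree x b} → Int x (node x L R)
    inl : Int x L → Int x (node c L R)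
    inr : Int x R → Int x (node c L R)

  In : Fin N → Tree a b → Set
  In {a} {b} x t = x ≡ a ⊎ x ≡ b ⊎ Int x t

  data Edge : Fin N → Fin N → Tree a b → Set where
    base  : {t : Tree a b} → Edge a b t
    base′ : {t : Tree a b} → Edge b a t
    inl   : Edge x y L → Edge x y (node c L R)
    inr   : Edge x y R → Edge x y (node c L R)

  pattern start = inj₁ refl
  pattern end = inj₂ (inj₁ refl)
  pattern inner i = inj₂ (inj₂ i)

  mirror : Tree a b → Tree b a
  mirror leaf         = leaf
  mirror (node c L R) = node c (mirror R) (mirror L)

  in-left : In x L → In x (node c L R)
  in-left start     = start
  in-left end       = inner top
  in-left (inner i) = inner (inl i)

  in-right : In x R → In x (node c L R)
  in-right start     = inner top
  in-right end       = end
  in-right (inner i) = inner (inr i)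

  in-node : In x (node c L R) → In x L ⊎ In x R
  in-node start           = inj₁ start
  in-node end             = inj₂ end
  in-node (inner top)     = inj₁ end
  in-node (inner (inl i)) = inj₁ (inner i)
  in-node (inner (inr i)) = inj₂ (inner i)

  edge-sym : {t : Tree a b} → Edge x y t → Edge y x t
  edge-sym base    = base′
  edge-sym base′   = base
  edge-sym (inl e) = inl (edge-sym e)
  edge-sym (inr e) = inr (edge-sym e)

  edge-inˡ : {t : Tree a b} → Edge x y t → In x t
  edge-inˡ base    = start
  edge-inˡ base′   = end
  edge-inˡ (inl e) = in-left (edge-inˡ e)
  edge-inˡ (inr e) = in-right (edge-inˡ e)

  edge-inʳ : {t : Tree a b} → Edge x y t → In y t
  edge-inʳ e = edge-inˡ (edge-sym e)

  mirror-int : {t : Tree a b} → Int x t → Int x (mirror t)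
  mirror-int top     = top
  mirror-int (inl i) = inr (mirror-int i)
  mirror-int (inr i) = inl (mirror-int i)

  mirror-int⁻ : (t : Tree a b) → Int x (mirror t) → Int x t
  mirror-int⁻ (node c L R) top     = top
  mirror-int⁻ (node c L R) (inl i) = inr (mirror-int⁻ R i)
  mirror-int⁻ (node c L R) (inr i) = inl (mirror-int⁻ L i)

  mirror-in : {t : Tree a b} → In x t → In x (mirror t)
  mirror-in start     = end
  mirror-in end       = start
  mirror-in (inner i) = inner (mirror-int i)

  mirror-in⁻ : (t : Tree a b) → In x (mirror t) → In x t
  mirror-in⁻ t start     = end
  mirror-in⁻ t end       = start
  mirror-in⁻ t (inner i) = inner (mirror-int⁻ t i)

  mirror-edge : {t : Tree a b} → Edge x y t → Edge x y (mirror t)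
  mirror-edge base    = base′
  mirror-edge base′   = base
  mirror-edge (inl e) = inr (mirror-edge e)
  mirror-edge (inr e) = inl (mirror-edge e)

  mirror-edge⁻ : (t : Tree a b) → Edge x y (mirror t) → Edge x y t
  mirror-edge⁻ leaf base = base′
  mirror-edge⁻ leaf base′ = base
  mirror-edge⁻ (node c L R) base  = base′
  mirror-edge⁻ (node c L R) base′ = base
  mirror-edge⁻ (node c L R) (inl e) = inr (mirror-edge⁻ R e)
  mirror-edge⁻ (node c L R) (inr e) = inl (mirror-edge⁻ L e)

  -- Equivalent to all vertices being pairwise distinct, in a form that passes to subtrees.
  Dist : Tree a b → Set
  Dist {a} {b} leaf     = a ≢ b
  Dist (node c L R) = Dist L × Dist R × (∀ {x} → In x L → In x R → x ≡ c)

  ends-distinct : (t : Tree a b) → Dist t → a ≢ b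
  ends-distinct leaf d = d
  ends-distinct (node c L R) (dL , dR , dis) refl = ends-distinct L dL (dis start end)

  int≢start : (t : Tree a b) → Dist t → ¬ Int a t
  int≢end   : (t : Tree a b) → Dist t → ¬ Int b t
  int≢start (node c L R) (dL , _ , _) top = ends-distinct L dL refl
  int≢start (node c L R) (dL , _ , _) (inl i) = int≢start L dL i
  int≢start (node c L R) (dL , _ , dis) (inr i) = ends-distinct L dL (dis start (inner i))
  int≢end (node c L R) (_ , dR , _) top = ends-distinct R dR refl
  int≢end (node c L R) (_ , dR , _) (inr i) = int≢end R dR i
  int≢end (node c L R) (_ , dR , dis) (inl i) = ends-distinct R dR (sym (dis (inner i) end))

  dist-mirror : (t : Tree a b) → Dist t → Dist (mirror t)
  dist-mirror leaf d = λ e → d (sym e)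
  dist-mirror (node c L R) (dL , dR , dis) =
    dist-mirror R dR , dist-mirror L dL , λ i j → dis (mirror-in⁻ L j) (mirror-in⁻ R i)

  edge-irrefl : (t : Tree a b) → Dist t → ¬ Edge x x t
  edge-irrefl t d base  = ends-distinct t d refl
  edge-irrefl t d base′ = ends-distinct t d refl
  edge-irrefl (node c L R) (dL , _ , _) (inl e) = edge-irrefl L dL e
  edge-irrefl (node c L R) (_ , dR , _) (inr e) = edge-irrefl R dR e

  module _ (L : Tree a c) (R : Tree c b) (d : Dist (node c L R)) where
    private
      dL = proj₁ d
      dR = proj₁ (proj₂ d)
      dis : ∀ {x} → In x L → In x R → x ≡ c
      dis = proj₂ (proj₂ d)

    start∉right : ¬ In a R
    start∉right i = ends-distinct L dL (dis start i)

    end∉left : ¬ In b L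
    end∉left i = ends-distinct R dR (sym (dis i end))

    intL∉R : Int x L → ¬ In x R
    intL∉R i j with dis (inner i) j
    ... | refl = int≢end L dL i

    intR∉L : Int x R → ¬ In x L
    intR∉L i j with dis j (inner i)
    ... | refl = int≢start R dR i

  Int? : ∀ x (t : Tree a b) → Dec (Int x t)
  Int? x leaf = no λ ()
  Int? x (node c L R) with x ≟ c
  ... | yes refl = yes top
  ... | no x≢c with Int? x L
  ...   | yes i = yes (inl i)
  ...   | no ∉L with Int? x R
  ...     | yes i = yes (inr i)
  ...     | no ∉R = no λ where
                top → x≢c refl
                (inl i) → ∉L i
                (inr i) → ∉R i

  In? : ∀ x (t : Tree a b) → Dec (In x t)
  In? {a} {b} x t with x ≟ a | x ≟ b | Int? x t
  ... | yes e | _ | _ = yes (inj₁ e)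
  ... | no _  | yes e | _ = yes (inj₂ (inj₁ e))
  ... | no _  | no _ | yes i = yes (inner i)
  ... | no p  | no q | no r = no λ where
    (inj₁ e) → p e
    (inj₂ (inj₁ e)) → q e
    (inner i) → r i

  -- A triangulated polygon minus two vertices stays connected unless the two are adjacent;
  -- p = q covers the removal of a single vertex.
  connected-minus : (t : Tree a b) → Dist t → (p q : Fin N) → ¬ Edge p q t →
    (C : Fin N → Set) →
    (∀ {x y} → Edge x y t → x ≢ p → x ≢ q → y ≢ p → y ≢ q → C x → C y) →
    ∀ {x y} → In x t → In y t → x ≢ p → x ≢ q → y ≢ p → y ≢ q → C x → C y
  connected-minus leaf d p q ¬e C cl start     start     x₁ x₂ y₁ y₂ h = h
  connected-minus leaf d p q ¬e C cl start     end       x₁ x₂ y₁ y₂ h = cl base x₁ x₂ y₁ y₂ h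
  connected-minus leaf d p q ¬e C cl end       start     x₁ x₂ y₁ y₂ h = cl base′ x₁ x₂ y₁ y₂ h
  connected-minus leaf d p q ¬e C cl end       end       x₁ x₂ y₁ y₂ h = h
  connected-minus {a} {b} (node c L R) (dL , dR , dis) p q ¬e C cl i j x₁ x₂ y₁ y₂ h
    = go (in-node i) (in-node j) bridge
    where
    connL : ∀ {x y} → In x L → In y L → x ≢ p → x ≢ q → y ≢ p → y ≢ q → C x → C y
    connL = connected-minus L dL p q (λ e → ¬e (inl e)) C (λ e → cl (inl e))
    connR : ∀ {x y} → In x R → In y R → x ≢ p → x ≢ q → y ≢ p → y ≢ q → C x → C y
    connR = connected-minus R dR p q (λ e → ¬e (inr e)) C (λ e → cl (inr e))
    -- If the apex survives, it joins the two halves. If it is removed, then neither `a` nor `b` is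
    -- the other removed vertex, both being adjacent to `c`; so the edge `ab` survives and joins
    -- them.
    Bridge = (c ≢ p × c ≢ q) ⊎ ((a ≢ p × a ≢ q) × (b ≢ p × b ≢ q))
    bridge : Bridge
    bridge with c ≟ p
    ... | yes refl = inj₂ ( (ends-distinct L dL , (λ { refl → ¬e (inl base′) }))
                          , ((λ e → ends-distinct R dR (sym e)) , (λ { refl → ¬e (inr base) })))
    ... | no c≢p with c ≟ q
    ...   | no c≢q = inj₁ (c≢p , c≢q)
    ...   | yes refl = inj₂ ( ((λ { refl → ¬e (inl base) }) , ends-distinct L dL)
                            , ((λ { refl → ¬e (inr base′) }) , (λ e → ends-distinct R dR (sym e))))
    go : _ → _ → Bridge → C _
    go (inj₁ i) (inj₁ j) _ = connL i j x₁ x₂ y₁ y₂ h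
    go (inj₂ i) (inj₂ j) _ = connR i j x₁ x₂ y₁ y₂ h
    go (inj₁ i) (inj₂ j) (inj₁ (c₁ , c₂)) =
      connR start j c₁ c₂ y₁ y₂ (connL i end x₁ x₂ c₁ c₂ h)
    go (inj₂ i) (inj₁ j) (inj₁ (c₁ , c₂)) =
      connL end j c₁ c₂ y₁ y₂ (connR i start x₁ x₂ c₁ c₂ h)
    go (inj₁ i) (inj₂ j) (inj₂ ((a₁ , a₂) , b₁ , b₂)) =
      connR end j b₁ b₂ y₁ y₂ (cl base a₁ a₂ b₁ b₂ (connL i start x₁ x₂ a₁ a₂ h))
    go (inj₂ i) (inj₁ j) (inj₂ ((a₁ , a₂) , b₁ , b₂)) =
      connL start j a₁ a₂ y₁ y₂ (cl base′ b₁ b₂ a₁ a₂ (connR i end x₁ x₂ b₁ b₂ h))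

  record IsTree (G : Graph N) (t : Tree a b) : Set where
    field
      V⇒In  : ∀ {x} → x ∈V G → In x t
      In⇒V  : ∀ {x} → In x t → x ∈V G
      A⇒E   : ∀ {x y} → Adj G x y → Edge x y t
      E⇒A   : ∀ {x y} → Edge x y t → Adj G x y
      dist  : Dist t
  open IsTree public

  -- t is the part of G cut off by the edge ab.
  record Part (G : Graph N) (t : Tree a b) : Set where
    field
      edge⇒adj : ∀ {x y} → Edge x y t → Adj G x y
      closed   : ∀ {x y} → Int x t → Adj G x y → Edge x y t
      induced  : ∀ {x y} → In x t → In y t → Adj G x y → Edge x y t
      dst      : Dist t
  open Part public

  IsTree⇒Part : {G : Graph N} {t : Tree a b} → IsTree G t → Part G t
  IsTree⇒Part T = record
    { edge⇒adj = E⇒A T ; closed = λ _ → A⇒E T ; induced = λ _ _ → A⇒E T ; dst = dist T }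

  IsTree-mirror : {G : Graph N} {t : Tree a b} → IsTree G t → IsTree G (mirror t)
  IsTree-mirror {t = t} T = record
    { V⇒In = λ x → mirror-in (V⇒In T x)
    ; In⇒V = λ x → In⇒V T (mirror-in⁻ t x)
    ; A⇒E  = λ e → mirror-edge (A⇒E T e)
    ; E⇒A  = λ e → E⇒A T (mirror-edge⁻ t e)
    ; dist = dist-mirror t (dist T) }

  module _ {G : Graph N} where

    part-mirror : {t : Tree a b} → Part G t → Part G (mirror t)
    part-mirror {t = t} S = record
      { edge⇒adj = λ e → edge⇒adj S (mirror-edge⁻ t e)
      ; closed   = λ i e → mirror-edge (closed S (mirror-int⁻ t i) e)
      ; induced  = λ i j e → mirror-edge (induced S (mirror-in⁻ t i) (mirror-in⁻ t j) e)
      ; dst      = dist-mirror t (dst S) }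

    private
      restrictˡ : (L : Tree a c) (R : Tree c b) → Dist (node c L R) →
        In x L → In y L → Edge x y (node c L R) → Edge x y L
      restrictˡ L R d i j base  = contradiction j (end∉left L R d)
      restrictˡ L R d i j base′ = contradiction i (end∉left L R d)
      restrictˡ L R d i j (inl e) = e
      restrictˡ L R d i j (inr e)
        with proj₂ (proj₂ d) i (edge-inˡ e) | proj₂ (proj₂ d) j (edge-inʳ e)
      ... | refl | refl = contradiction e (edge-irrefl R (proj₁ (proj₂ d)))

      closedˡ : (L : Tree a c) (R : Tree c b) → Dist (node c L R) →
        Int x L → Edge x y (node c L R) → Edge x y L
      closedˡ L R d i base  = contradiction i (int≢start L (proj₁ d))
      closedˡ L R d i base′ = contradiction (inner i) (end∉left L R d)
      closedˡ L R d i (inl e) = e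
      closedˡ L R d i (inr e) = contradiction (edge-inˡ e) (intL∉R L R d i)

    part-left : {L : Tree a c} {R : Tree c b} → Part G (node c L R) → Part G L
    part-left {L = L} {R} S = record
      { edge⇒adj = λ e → edge⇒adj S (inl e)
      ; closed   = λ i e → closedˡ L R (dst S) i (closed S (inl i) e)
      ; induced  = λ i j e → restrictˡ L R (dst S) i j (induced S (in-left i) (in-left j) e)
      ; dst      = proj₁ (dst S) }

    part-right : {L : Tree a c} {R : Tree c b} → Part G (node c L R) → Part G R
    part-right {L = L} {R} S = record
      { edge⇒adj = λ e → edge⇒adj S (inr e)
      ; closed   = λ i e → mirror-edge⁻ R (closed M (mirror-int i) e)
      ; induced  = λ i j e → mirror-edge⁻ R (induced M (mirror-in i) (mirror-in j) e)
      ; dst      = proj₁ (proj₂ (dst S)) }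
      where
      M : Part G (mirror R)
      M = part-left (part-mirror S)

  -- Bonnet systems of a triangulated polygon.  LP d t describes the bonnet on one side of the apex of
  -- the cap: the first end of t is an end of the cap, next hangs a subtree between consecutive
  -- neighbours of it, and at turn the ribbon leaves the neighbours of that end, the remaining ones
  -- forming the fan.
  data BS  : ℕ → Tree a b → Set
  data LP  : ℕ → Tree a b → Set
  data Rib : ℕ → Tree a b → Set
  data Fan : ℕ → Tree a b → Set

  data BS where
    leaf : BS d (leaf {a = a} {b = b})
    -- Mirroring makes `b` the first index, so that one family serves both ends of the cap. The
    -- depth is raised here only.
    node : LP d L → LP d (mirror R) → BS (suc d) (node c L R)

  data LP where
    leaf : LP d (leaf {a = a} {b = b})
    next : LP d L → BS d R → LP d (node c L R)
    turn : Fan d L → Rib d R → LP d (node c L R)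

  data Rib where
    leaf  : Rib d (leaf {a = a} {b = b})
    left  : Rib d L → BS d R → Rib d (node c L R)
    right : BS d L → Rib d R → Rib d (node c L R)

  data Fan where
    leaf : Fan d (leaf {a = a} {b = b})
    node : Fan d L → BS d R → Fan d (node c L R)

  -- A fan is a side at which the ribbon never turns off: only hanging subtrees follow, down to the
  -- last edge.
  Fan⇒LP : {t : Tree a b} → Fan d t → LP d t
  Fan⇒LP leaf = leaf
  Fan⇒LP (node f s) = next (Fan⇒LP f) s

  -- Grid drawings

  -- A solid cell lies on the segment of its label, any other cell may be crossed by its edges.
  record Cell : Set where
    constructor mkCell
    field
      label : Fin N
      solid : Bool
  open Cell public

  pattern home w = mkCell w true
  pattern fill w = mkCell w false

  home-injective : home x ≡ home y → x ≡ y
  home-injective refl = refl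

  Col : ℕ → Set
  Col h = Fin h → Cell

  Grid : ℕ → Set
  Grid h = List (Col h)

  private variable
    k : Fin h
    col : Col h
    g g′ : Grid h

  At : Fin h → Fin N → Col h → Set
  At k w col = col k ≡ home w × (∀ j → col j ≡ home w → j ≡ k)

  Abs : Fin N → Col h → Set
  Abs w col = ∀ j → col j ≢ home w

  On : Fin h → Fin N → Grid h → Set
  On k w = All (At k w)

  Off : Fin N → Grid h → Set
  Off w = All (Abs w)

  -- The homes of `w` form a single run in row `k`. `Pre` touches the left border and `Suf` the
  -- right one, so a vertex shared by two grids put side by side gets one segment when a `Suf` meets
  -- a `Pre` in the same row.
  data Pre (k : Fin h) (w : Fin N) : Grid h → Set where
    last : At k w col → Off w g → Pre k w (col ∷ g)
    _∷_  : At k w col → Pre k w g → Pre k w (col ∷ g)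

  data Suf (k : Fin h) (w : Fin N) : Grid h → Set where
    on  : At k w col → On k w g → Suf k w (col ∷ g)
    _∷_ : Abs w col → Suf k w g → Suf k w (col ∷ g)

  data Mid (k : Fin h) (w : Fin N) : Grid h → Set where
    pre : Pre k w g → Mid k w g
    _∷_ : Abs w col → Mid k w g → Mid k w (col ∷ g)

  pre-off : Pre k w g → Off w g′ → Pre k w (g ++ g′)
  pre-off (last p q) o = last p (All.++⁺ q o)
  pre-off (p ∷ q) o = p ∷ pre-off q o

  on-pre : On k w g → Pre k w g′ → Pre k w (g ++ g′)
  on-pre [] q = q
  on-pre (p ∷ ps) q = p ∷ on-pre ps q

  off-suf : Off w g → Suf k w g′ → Suf k w (g ++ g′)
  off-suf [] q = q
  off-suf (p ∷ ps) q = p ∷ off-suf ps q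

  suf-on : Suf k w g → On k w g′ → Suf k w (g ++ g′)
  suf-on (on p ps) q = on p (All.++⁺ ps q)
  suf-on (p ∷ ps) q = p ∷ suf-on ps q

  on⇒pre : At k w col → On k w g → Pre k w (col ∷ g)
  on⇒pre p [] = last p []
  on⇒pre p (q ∷ qs) = p ∷ on⇒pre q qs

  suf-pre : Suf k w g → Pre k w g′ → Mid k w (g ++ g′)
  suf-pre (on p ps) q = pre (on-pre (p ∷ ps) q)
  suf-pre (p ∷ ps) q = p ∷ suf-pre ps q

  off-mid : Off w g → Mid k w g′ → Mid k w (g ++ g′)
  off-mid [] q = q
  off-mid (p ∷ ps) q = p ∷ off-mid ps q

  mid-off : Mid k w g → Off w g′ → Mid k w (g ++ g′)
  mid-off (pre p) q = pre (pre-off p q)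
  mid-off (p ∷ ps) q = p ∷ mid-off ps q

  suf⇒mid : Suf k w g → Mid k w g
  suf⇒mid (on p ps) = pre (on⇒pre p ps)
  suf⇒mid (p ∷ ps) = p ∷ suf⇒mid ps

  rev : {A : Set} → List A → List A
  rev [] = []
  rev (p ∷ ps) = rev ps ++ (p ∷ [])

  all-rev : {A : Set} {P : A → Set} {xs : List A} → All P xs → All P (rev xs)
  all-rev [] = []
  all-rev (p ∷ ps) = All.++⁺ (all-rev ps) (p ∷ [])

  any-rev : {A : Set} {P : A → Set} {xs : List A} → Any P xs → Any P (rev xs)
  any-rev {xs = _ ∷ xs} (here p) = Any.++⁺ʳ (rev xs) (here p)
  any-rev (there p) = Any.++⁺ˡ (any-rev p)

  pre-rev : Pre k w g → Suf k w (rev g)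
  pre-rev (last p q) = off-suf (all-rev q) (on p [])
  pre-rev (p ∷ q) = suf-on (pre-rev q) (p ∷ [])

  suf-rev : Suf k w g → Pre k w (rev g)
  suf-rev (on p q) = on-pre (all-rev q) (last p [])
  suf-rev (p ∷ q) = pre-off (suf-rev q) (p ∷ [])

  mid-rev : Mid k w g → Mid k w (rev g)
  mid-rev (pre p) = suf⇒mid (pre-rev p)
  mid-rev (p ∷ q) = mid-off (mid-rev q) (p ∷ [])

  VEdge : Fin N → Fin N → Col h → Set
  VEdge u v col = ∃[ i ] ∃[ j ] (col i ≡ home u × col j ≡ home v
    × (∀ m → Between i m j → label (col m) ≡ u ⊎ label (col m) ≡ v))

  data HEdge (u v : Fin N) : Grid h → Set where
    here  : ∀ {col col′ : Col h} {g} k → col k ≡ home u → col′ k ≡ home v →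
            HEdge u v (col ∷ col′ ∷ g)
    there : HEdge u v g → HEdge u v (col ∷ g)

  Drawn : Fin N → Fin N → Grid h → Set
  Drawn u v g = Any (VEdge u v) g ⊎ (HEdge u v g ⊎ HEdge v u g)

  vedge-sym : VEdge u v col → VEdge v u col
  vedge-sym (i , j , p , q , r) = j , i , q , p , λ m bt → Sum.swap (r m (Sum.swap bt))

  drawn-sym : Drawn u v g → Drawn v u g
  drawn-sym (inj₁ p) = inj₁ (Any.map vedge-sym p)
  drawn-sym (inj₂ p) = inj₂ (Sum.swap p)

  hedge-++ˡ : HEdge u v g → HEdge u v (g ++ g′)
  hedge-++ˡ (here k p q) = here k p q
  hedge-++ˡ (there p) = there (hedge-++ˡ p)

  hedge-++ʳ : ∀ (g : Grid h) {g′} → HEdge u v g′ → HEdge u v (g ++ g′)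
  hedge-++ʳ [] p = p
  hedge-++ʳ (_ ∷ g) p = there (hedge-++ʳ g p)

  drawn-++ˡ : Drawn u v g → Drawn u v (g ++ g′)
  drawn-++ˡ = Sum.map Any.++⁺ˡ (Sum.map hedge-++ˡ hedge-++ˡ)

  drawn-++ʳ : ∀ (g : Grid h) {g′} → Drawn u v g′ → Drawn u v (g ++ g′)
  drawn-++ʳ g = Sum.map (Any.++⁺ʳ g) (Sum.map (hedge-++ʳ g) (hedge-++ʳ g))

  suf-pre-hedge : Suf k u g → Pre k v g′ → HEdge u v (g ++ g′)
  suf-pre-hedge {k = k} (on p []) (last q _) = here k (proj₁ p) (proj₁ q)
  suf-pre-hedge {k = k} (on p []) (q ∷ _) = here k (proj₁ p) (proj₁ q)
  suf-pre-hedge (on p (p′ ∷ ps)) q = there (suf-pre-hedge (on p′ ps) q)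
  suf-pre-hedge (p ∷ ps) q = there (suf-pre-hedge ps q)

  hedge-rev : HEdge u v g → HEdge v u (rev g)
  hedge-rev (here {col = col} {col′} {g} k p q) = sub (rev g)
    where
    sub : ∀ g → HEdge _ _ ((g ++ (col′ ∷ [])) ++ (col ∷ []))
    sub [] = here k q p
    sub (_ ∷ g) = there (sub g)
  hedge-rev (there p) = hedge-++ˡ (hedge-rev p)

  drawn-rev : Drawn u v g → Drawn u v (rev g)
  drawn-rev (inj₁ p) = inj₁ (any-rev p)
  drawn-rev (inj₂ p) = inj₂ (Sum.swap (Sum.map hedge-rev hedge-rev p))

  -- A row-wise embedding of columns; Ok w says that the added cells are not homes of w.
  record Embed (f : Col h → Col h′) (Ok : Fin N → Set) : Set where
    field
      pos    : Fin h → Fin h′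
      pos-eq : ∀ col j → f col (pos j) ≡ col j
      back   : ∀ col j w → Ok w → f col j ≡ home w → ∃[ i ] j ≡ pos i
      betw   : ∀ i m j → Between (pos i) m (pos j) → ∃[ n ] (m ≡ pos n × Between i n j)

    at : Ok w → At k w col → At (pos k) w (f col)
    at {k = k} {col = col} ok (p , q) = trans (pos-eq col k) p , λ j e → aux j e (back col j _ ok e)
      where
      aux : ∀ j → f col j ≡ home _ → ∃[ i ] j ≡ pos i → j ≡ pos k
      aux _ e (i , refl) = cong pos (q i (trans (sym (pos-eq col i)) e))

    abs : Ok w → Abs w col → Abs w (f col)
    abs {col = col} ok p j e with back col j _ ok e
    ... | i , refl = p i (trans (sym (pos-eq col i)) e)

    on-map : Ok w → On k w g → On (pos k) w (map f g)
    on-map ok = All.map⁺ ∘ All.map (at ok)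

    off-map : Ok w → Off w g → Off w (map f g)
    off-map ok = All.map⁺ ∘ All.map (abs ok)

    pre-map : Ok w → Pre k w g → Pre (pos k) w (map f g)
    pre-map ok (last p q) = last (at ok p) (off-map ok q)
    pre-map ok (p ∷ q) = at ok p ∷ pre-map ok q

    suf-map : Ok w → Suf k w g → Suf (pos k) w (map f g)
    suf-map ok (on p q) = on (at ok p) (on-map ok q)
    suf-map ok (p ∷ q) = abs ok p ∷ suf-map ok q

    mid-map : Ok w → Mid k w g → Mid (pos k) w (map f g)
    mid-map ok (pre p) = pre (pre-map ok p)
    mid-map ok (p ∷ q) = abs ok p ∷ mid-map ok q

    vedge : VEdge u v col → VEdge u v (f col)
    vedge {u} {v} {col = col} (i , j , p , q , r) =
      pos i , pos j , trans (pos-eq col i) p , trans (pos-eq col j) q , λ m bt → aux m (betw i m j bt)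
      where
      aux : ∀ m → ∃[ n ] (m ≡ pos n × Between i n j) →
            label (f col m) ≡ u ⊎ label (f col m) ≡ v
      aux _ (n , refl , bt) rewrite pos-eq col n = r n bt

    hedge-map : HEdge u v g → HEdge u v (map f g)
    hedge-map (here {col = col} {col′ = col′} k p q) =
      here (pos k) (trans (pos-eq col k) p) (trans (pos-eq col′ k) q)
    hedge-map (there p) = there (hedge-map p)

    drawn-map : Drawn u v g → Drawn u v (map f g)
    drawn-map = Sum.map (Any.map⁺ ∘ Any.map vedge) (Sum.map hedge-map hedge-map)

  infixr 5 _◁_
  _◁_ : Cell → Col h → Col (suc h)
  (x ◁ col) zero    = x
  (x ◁ col) (suc j) = col j

  ◁-embed : (x : Cell) → Embed {h} (x ◁_) (λ w → x ≢ home w)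
  ◁-embed x = record
    { pos = suc ; pos-eq = λ _ _ → refl ; back = bk ; betw = bt }
    where
    bk : ∀ col j w → x ≢ home w → (x ◁ col) j ≡ home w → ∃[ i ] j ≡ suc i
    bk col zero w ok e = contradiction e ok
    bk col (suc j) w ok e = j , refl
    bt : ∀ i m j → Between (suc i) m (suc j) → ∃[ n ] (m ≡ suc n × Between i n j)
    bt i (suc m) j (inj₁ (s≤s p , s≤s q)) = m , refl , inj₁ (p , q)
    bt i (suc m) j (inj₂ (s≤s p , s≤s q)) = m , refl , inj₂ (p , q)
    bt i zero j (inj₁ (() , _))
    bt i zero j (inj₂ (() , _))

  flip : Col h → Col h
  flip col j = col (opposite j)

  opposite-anti : (i j : Fin h) → toℕ i ≤ℕ toℕ j → toℕ (opposite j) ≤ℕ toℕ (opposite i)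
  opposite-anti {h} i j p rewrite opposite-prop i | opposite-prop j = ℕ.∸-monoʳ-≤ h (s≤s p)

  flip-embed : Embed {h} flip (λ _ → ⊤)
  flip-embed = record
    { pos = opposite
    ; pos-eq = λ col j → cong col (opposite-involutive j)
    ; back = λ _ j _ _ _ → opposite j , sym (opposite-involutive j)
    ; betw = λ i m j bt → opposite m , sym (opposite-involutive m) , bt′ i m j bt }
    where
    lower : ∀ i m → toℕ (opposite i) ≤ℕ toℕ m → toℕ (opposite m) ≤ℕ toℕ i
    lower i m p = subst (λ z → toℕ (opposite m) ≤ℕ toℕ z) (opposite-involutive i)
                    (opposite-anti (opposite i) m p)
    upper : ∀ i m → toℕ m ≤ℕ toℕ (opposite i) → toℕ i ≤ℕ toℕ (opposite m)
    upper i m p = subst (λ z → toℕ z ≤ℕ toℕ (opposite m)) (opposite-involutive i)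
                    (opposite-anti m (opposite i) p)
    bt′ : ∀ i m j → Between (opposite i) m (opposite j) → Between i (opposite m) j
    bt′ i m j (inj₁ (p , q)) = inj₂ (upper j m q , lower i m p)
    bt′ i m j (inj₂ (p , q)) = inj₁ (upper i m q , lower j m p)

  infixl 6 _▷_
  _▷_ : Col h → Cell → Col (suc h)
  _▷_ {zero}  col x _       = x
  _▷_ {suc h} col x zero    = col zero
  _▷_ {suc h} col x (suc j) = (col ∘ suc ▷ x) j

  ▷-inject : ∀ (col : Col h) x j → (col ▷ x) (inject₁ j) ≡ col j
  ▷-inject {suc h} col x zero = refl
  ▷-inject {suc h} col x (suc j) = ▷-inject (col ∘ suc) x j

  ▷-last : ∀ (col : Col h) x → (col ▷ x) (fromℕ h) ≡ x
  ▷-last {zero} col x = refl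
  ▷-last {suc h} col x = ▷-last (col ∘ suc) x

  inject-or-last : (j : Fin (suc h)) → (∃[ i ] j ≡ inject₁ i) ⊎ j ≡ fromℕ h
  inject-or-last {zero} zero = inj₂ refl
  inject-or-last {suc h} zero = inj₁ (zero , refl)
  inject-or-last {suc h} (suc j) with inject-or-last j
  ... | inj₁ (i , refl) = inj₁ (suc i , refl)
  ... | inj₂ refl = inj₂ refl

  last>inject : (i : Fin h) → ¬ (toℕ (fromℕ h) ≤ℕ toℕ (inject₁ i))
  last>inject {h} i p rewrite toℕ-fromℕ h | toℕ-inject₁ i = ℕ.<⇒≱ (toℕ<n i) p

  ▷-embed : (x : Cell) → Embed {h} (_▷ x) (λ w → x ≢ home w)
  ▷-embed {h} x = record
    { pos = inject₁ ; pos-eq = λ col → ▷-inject col x ; back = bk ; betw = bt }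
    where
    bk : ∀ col j w → x ≢ home w → (col ▷ x) j ≡ home w → ∃[ i ] j ≡ inject₁ i
    bk col j w ok e with inject-or-last j
    ... | inj₁ p = p
    ... | inj₂ refl = contradiction (trans (sym (▷-last col x)) e) ok
    down : ∀ i m j → Between (inject₁ i) (inject₁ m) (inject₁ j) → Between i m j
    down i m j p rewrite toℕ-inject₁ i | toℕ-inject₁ m | toℕ-inject₁ j = p
    bt : ∀ i m j → Between (inject₁ i) m (inject₁ j) → ∃[ n ] (m ≡ inject₁ n × Between i n j)
    bt i m j p with inject-or-last m
    bt i m j p | inj₁ (n , refl) = n , refl , down i n j p
    bt i m j (inj₁ (_ , p)) | inj₂ refl = contradiction p (last>inject j)
    bt i m j (inj₂ (_ , p)) | inj₂ refl = contradiction p (last>inject i)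

  -- A column reserved for the edge `ab`, drawn vertically over the full height; the cells between
  -- the two homes carry the label `a` so that the edge may cross them.
  bar : Fin N → Fin N → Col (suc (suc h))
  bar a b = home a ◁ (λ _ → fill a) ▷ home b

  bar-cell : ∀ (a b : Fin N) (j : Fin (suc (suc h))) →
    (j ≡ zero × bar a b j ≡ home a) ⊎ (j ≡ fromℕ (suc h) × bar a b j ≡ home b)
    ⊎ (bar a b j ≡ fill a)
  bar-cell a b zero = inj₁ (refl , refl)
  bar-cell {h} a b (suc j) with inject-or-last j
  ... | inj₁ (i , refl) = inj₂ (inj₂ (▷-inject {h} (λ _ → fill a) (home b) i))
  ... | inj₂ refl = inj₂ (inj₁ (refl , ▷-last {h} (λ _ → fill a) (home b)))

  bar-vedge : VEdge a b (bar {h} a b)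
  bar-vedge {a} {b} {h} = zero , fromℕ (suc h) , refl , ▷-last {h} (λ _ → fill a) (home b) , lab
    where
    lab : ∀ m → _ → label (bar a b m) ≡ a ⊎ label (bar a b m) ≡ b
    lab m _ with bar-cell a b m
    ... | inj₁ (_ , e) = inj₁ (cong label e)
    ... | inj₂ (inj₁ (_ , e)) = inj₂ (cong label e)
    ... | inj₂ (inj₂ e) = inj₁ (cong label e)

  bar-home : (j : Fin (suc (suc h))) → bar a b j ≡ home w →
             (j ≡ zero × w ≡ a) ⊎ (j ≡ fromℕ (suc h) × w ≡ b)
  bar-home {h} {a} {b} j e with bar-cell a b j
  ... | inj₁ (p , q) = inj₁ (p , home-injective (trans (sym e) q))
  ... | inj₂ (inj₁ (p , q)) = inj₂ (p , home-injective (trans (sym e) q))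
  ... | inj₂ (inj₂ q) = contradiction (trans (sym e) q) λ ()

  bar-start : a ≢ b → At zero a (bar {h} a b)
  bar-start a≢b = refl , λ j e → [ proj₁ , (λ p → contradiction (proj₂ p) a≢b) ] (bar-home j e)

  bar-end : a ≢ b → At (fromℕ (suc h)) b (bar {h} a b)
  bar-end {a} {b} {h} a≢b = ▷-last {h} (λ _ → fill a) (home b) ,
    λ j e → [ (λ p → contradiction (sym (proj₂ p)) a≢b) , proj₁ ] (bar-home j e)

  bar-abs : w ≢ a → w ≢ b → Abs w (bar {h} a b)
  bar-abs p q j e = [ p ∘ proj₂ , q ∘ proj₂ ] (bar-home j e)

  -- The grid g draws t up to the segments of its two ends; O bounds the vertices with a home in g.
  record Piece (O : Fin N → Set) (t : Tree a b) (g : Grid h) : Set where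
    field
      own : ∀ {w} → ¬ O w → Off w g
      mid : ∀ {w} → Int w t → ∃[ k ] Mid k w g
      drw : ∀ {x y} → Edge x y t → Drawn x y g
  open Piece

  private variable
    O O′ : Fin N → Set

  piece-⊆ : (∀ {w} → O w → O′ w) → Piece O t g → Piece O′ t g
  piece-⊆ f P = record { own = λ ¬o → own P (¬o ∘ f) ; mid = mid P ; drw = drw P }

  piece-mirror⁻ : (t : Tree a b) → Piece O (mirror t) g → Piece O t g
  piece-mirror⁻ t P = record
    { own = own P ; mid = mid P ∘ mirror-int ; drw = drw P ∘ mirror-edge }

  piece-mirror : Piece O t g → Piece O (mirror t) g
  piece-mirror {t = t} P = record
    { own = own P ; mid = mid P ∘ mirror-int⁻ t ; drw = drw P ∘ mirror-edge⁻ t }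

  piece-rev : Piece O t g → Piece O t (rev g)
  piece-rev P = record
    { own = all-rev ∘ own P
    ; mid = λ i → let k , p = mid P i in k , mid-rev p
    ; drw = drawn-rev ∘ drw P }

  piece-flip : Piece O t g → Piece O t (map flip g)
  piece-flip P = record
    { own = off-map tt ∘ own P
    ; mid = λ i → let k , p = mid P i in opposite k , mid-map tt p
    ; drw = drawn-map ∘ drw P }
    where open Embed flip-embed

  private
    ok-home : x ≢ w → home x ≢ home w
    ok-home p refl = p refl

  piece-map : {f : Col h → Col h′} → Embed f (λ w → home x ≢ home w) → ¬ Int x t →
    Piece O t g → Piece (λ w → w ≡ x ⊎ O w) t (map f g)
  piece-map {x = x} {t} emb x∉t P = record
    { own = λ ¬o → off-map (λ { refl → ¬o (inj₁ refl) }) (own P (¬o ∘ inj₂))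
    ; mid = λ i → let k , p = mid P i in pos k , mid-map (ok-home λ { refl → x∉t i }) p
    ; drw = drawn-map ∘ drw P }
    where open Embed emb

  piece-fill : Piece O t g → Piece O t (map (fill x ◁_) g)
  piece-fill {x = x} P = record
    { own = λ ¬o → off-map (λ ()) (own P ¬o)
    ; mid = λ i → let k , p = mid P i in suc k , mid-map (λ ()) p
    ; drw = drawn-map ∘ drw P }
    where open Embed (◁-embed (fill x))

  -- Everything strictly inside one half is absent from the other grid and keeps its run. Only the
  -- apex and the root edge involve both halves, so these two are left to the caller.
  piece-node : ∀ {O₁ O₂} {L : Tree a c} {R : Tree c b} (g₁ g₂ : Grid h) →
    Piece O₁ L g₁ → Piece O₂ R g₂ →
    (∀ {w} → Int w L → ¬ O₂ w) → (∀ {w} → Int w R → ¬ O₁ w) →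
    ∃[ k ] Mid k c (g₁ ++ g₂) → Drawn a b (g₁ ++ g₂) →
    Piece (λ w → O₁ w ⊎ O₂ w) (node c L R) (g₁ ++ g₂)
  piece-node g₁ g₂ P Q dP dQ mc eab = record
    { own = λ ¬o → All.++⁺ (own P (¬o ∘ inj₁)) (own Q (¬o ∘ inj₂))
    ; mid = λ where
        top     → mc
        (inl i) → let k , p = mid P i in k , mid-off p (own Q (dP i))
        (inr i) → let k , p = mid Q i in k , off-mid (own P (dQ i)) p
    ; drw = λ where
        base    → eab
        base′   → drawn-sym eab
        (inl e) → drawn-++ˡ (drw P e)
        (inr e) → drawn-++ʳ g₁ (drw Q e) }

  piece-bar : Piece O t g → ¬ Int a t → ¬ Int b t →
    Piece (λ w → w ≡ a ⊎ w ≡ b ⊎ O w) t (g ++ (bar {h} a b ∷ []))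
  piece-bar P a∉t b∉t = record
    { own = λ ¬o → All.++⁺ (own P (¬o ∘ inj₂ ∘ inj₂))
                     (bar-abs (¬o ∘ inj₁) (¬o ∘ inj₂ ∘ inj₁) ∷ [])
    ; mid = λ i → let k , p = mid P i in
              k , mid-off p (bar-abs (λ { refl → a∉t i }) (λ { refl → b∉t i }) ∷ [])
    ; drw = drawn-++ˡ ∘ drw P }

  post : Fin N → Col (suc h)
  post a = home a ◁ (λ _ → fill a)

  post-at : At zero a (post {h} a)
  post-at = refl , λ { zero _ → refl ; (suc _) () }

  post-abs : w ≢ a → Abs w (post {h} a)
  post-abs p zero e = p (sym (home-injective e))

  -- A hung drawing has the root edge in its top row, from corner to corner.  A strip has a in its top
  -- row and b in its bottom row, both visible from the right.  In a fan strip, a fills the top row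
  -- and b starts at the left of the row below.
  record Hung {a b} (t : Tree a b) (g : Grid (suc h)) : Set where
    constructor mkHung
    field
      piece : Piece (λ w → In w t) t g
      first : Pre zero a g
      final : Suf zero b g

  record Strip {a b} (t : Tree a b) (g : Grid (suc (suc h))) : Set where
    constructor mkStrip
    field
      piece : Piece (λ w → In w t) t g
      upper : Suf zero a g
      lower : Suf (fromℕ (suc h)) b g

  record FanStrip {a b} (t : Tree a b) (g : Grid (suc (suc h))) : Set where
    constructor mkFan
    field
      piece : Piece (λ w → In w t) t g
      above : On zero a g
      first : Pre (suc zero) b g

  hung-leaf : a ≢ b → Hung {h} (leaf {a = a} {b = b}) (post a ∷ post b ∷ [])
  hung-leaf {a} {b} a≢b = record
    { piece = record
      { own = λ ¬o → post-abs (¬o ∘ inj₁) ∷ post-abs (¬o ∘ inj₂ ∘ inj₁) ∷ []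
      ; mid = λ ()
      ; drw = λ where
          base  → inj₂ (inj₁ (here zero refl refl))
          base′ → inj₂ (inj₂ (here zero refl refl)) }
    ; first = last post-at (post-abs a≢b ∷ [])
    ; final = post-abs (a≢b ∘ sym) ∷ on post-at [] }

  strip-leaf : a ≢ b → Strip {h} (leaf {a = a} {b = b}) (bar a b ∷ [])
  strip-leaf a≢b = record
    { piece = record
      { own = λ ¬o → bar-abs (¬o ∘ inj₁) (¬o ∘ inj₂ ∘ inj₁) ∷ []
      ; mid = λ ()
      ; drw = λ where
          base  → inj₁ (here bar-vedge)
          base′ → inj₁ (here (vedge-sym bar-vedge)) }
    ; upper = on (bar-start a≢b) []
    ; lower = on (bar-end a≢b) [] }

  beside : Grid (suc (suc h)) → Grid (suc h) → Fin N → Fin N → Grid (suc (suc h))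
  beside X Y a b = X ++ (map (home a ◁_) Y ++ (bar a b ∷ []))

  ◁-on : ∀ {g : Grid h} → Off a g → On zero a (map (home a ◁_) g)
  ◁-on [] = []
  ◁-on (p ∷ ps) = (refl , λ { zero _ → refl ; (suc j) e → contradiction e (p j) }) ∷ ◁-on ps

  ▷-on : ∀ {g : Grid h} → Off a g → On (fromℕ h) a (map (_▷ home a) g)
  ▷-on [] = []
  ▷-on {h} {a} {col ∷ _} (p ∷ ps) = (▷-last col (home a) , lst) ∷ ▷-on ps
    where
    lst : ∀ j → (col ▷ home a) j ≡ home a → j ≡ fromℕ h
    lst j e with inject-or-last j
    ... | inj₁ (i , refl) = contradiction (trans (sym (▷-inject col (home a) i)) e) (p i)
    ... | inj₂ q = q

  -- The triangle abc and the part behind bc are appended to a strip for the part behind ac: a runs on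
  -- above the upside-down drawing Y, whose root edge cb prolongs the bottom row.
  module _ {L : Tree a c} {R : Tree c b} (D : Dist (node c L R))
           {X : Grid (suc (suc h))} (SX : Strip L X)
           {Y : Grid (suc h)} (PY : Piece (λ w → In w R) R Y)
           (cY : Pre (fromℕ h) c Y) (bY : Suf (fromℕ h) b Y) where
    private
      module SX = Strip SX
      a≢b : a ≢ b
      a≢b = ends-distinct (node c L R) D
      a≢c : a ≢ c
      a≢c = ends-distinct L (proj₁ D)
      c≢b : c ≢ b
      c≢b = ends-distinct R (proj₁ (proj₂ D))
      a∉R : ¬ In a R
      a∉R = start∉right L R D
      open Embed (◁-embed {suc h} (home a))

      aY : On zero a (map (home a ◁_) Y ++ (bar a b ∷ []))
      aY = All.++⁺ (◁-on (own PY a∉R)) (bar-start a≢b ∷ [])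

      P : Piece (λ w → w ≡ a ⊎ w ≡ b ⊎ w ≡ a ⊎ In w R) R (map (home a ◁_) Y ++ (bar a b ∷ []))
      P = piece-bar (piece-map (◁-embed (home a)) (a∉R ∘ inner) PY)
            (a∉R ∘ inner) (int≢end R (proj₁ (proj₂ D)))

    strip-beside : Strip (node c L R) (beside X Y a b)
    strip-beside = record
      { piece = piece-⊆ bound (piece-node X _ SX.piece P
          (λ where
            i (inj₁ refl) → int≢start L (proj₁ D) i
            i (inj₂ (inj₁ refl)) → end∉left L R D (inner i)
            i (inj₂ (inj₂ (inj₁ refl))) → int≢start L (proj₁ D) i
            i (inj₂ (inj₂ (inj₂ j))) → intL∉R L R D i j)
          (intR∉L L R D)
          -- The run of `c` leaves the strip at the end of its last row and continues in the last
          -- row of `Y`.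
          (_ , suf-pre SX.lower (pre-off (pre-map (ok-home a≢c) cY)
                 (bar-abs (a≢c ∘ sym) c≢b ∷ [])))
          (drawn-++ʳ X (drawn-++ʳ (map (home a ◁_) Y) (inj₁ (here bar-vedge)))))
      ; upper = suf-on SX.upper aY
      ; lower = off-suf (own SX.piece (end∉left L R D))
                  (suf-on (suf-map (ok-home a≢b) bY) (bar-end a≢b ∷ [])) }
      where
      bound : ∀ {w} → In w L ⊎ w ≡ a ⊎ w ≡ b ⊎ w ≡ a ⊎ In w R → In w (node c L R)
      bound (inj₁ i) = in-left i
      bound (inj₂ (inj₁ refl)) = start
      bound (inj₂ (inj₂ (inj₁ refl))) = end
      bound (inj₂ (inj₂ (inj₂ (inj₁ refl)))) = start
      bound (inj₂ (inj₂ (inj₂ (inj₂ i)))) = in-right i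

    beside-on : On zero a X → On zero a (beside X Y a b)
    beside-on aX = All.++⁺ aX aY

  hung-rev : {t : Tree a b} → Hung {h} t g → Hung (mirror t) (rev g)
  hung-rev {t = t} (mkHung P s e) =
    mkHung (piece-⊆ mirror-in (piece-mirror (piece-rev P))) (suf-rev e) (pre-rev s)

  strip-flip⁻ : (t : Tree a b) → Strip {h} (mirror t) g → Strip t (map flip g)
  strip-flip⁻ {a} {h = h} {g = g} t (mkStrip P up lo) = mkStrip
    (piece-⊆ (mirror-in⁻ t) (piece-flip (piece-mirror⁻ t P)))
    -- The last row is `opposite zero` by definition, so flipping it returns to `zero` by
    -- involutivity.
    (subst (λ k → Suf k a (map flip g)) (opposite-involutive (zero {suc h})) (suf-map tt lo))
    (suf-map tt up)
    where open Embed flip-embed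

  strip-flip : {t : Tree a b} → Strip {h} t g → Strip (mirror t) (map flip g)
  strip-flip {b = b} {h = h} {g = g} {t = t} (mkStrip P up lo) = mkStrip
    (piece-⊆ mirror-in (piece-flip (piece-mirror P)))
    (subst (λ k → Suf k b (map flip g)) (opposite-involutive (zero {suc h})) (suf-map tt lo))
    (suf-map tt up)
    where open Embed flip-embed

  -- This is 2d. A hanging drawing has one row more, ribbon and fan strips two more, a side of the
  -- bonnet three more; the last number is 2(d + 1) + 1, the height due at the next depth.
  room : ℕ → ℕ
  room zero    = zero
  room (suc d) = suc (suc (room d))

  BSDrawing RibDrawing FanDrawing LPDrawing : ℕ → Tree a b → Set
  BSDrawing  d t = Σ (Grid (suc (room d))) (Hung t)
  RibDrawing d t = Σ (Grid (suc (suc (room d)))) (Strip t)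
  FanDrawing d t = Σ (Grid (suc (suc (room d)))) (FanStrip t)
  LPDrawing {a} d t = Σ (Grid (suc (suc (suc (room d))))) (λ g → Strip t g × On zero a g)

  rib-left : {L : Tree a c} {R : Tree c b} → Dist (node c L R) →
    RibDrawing d L → BSDrawing d R → RibDrawing d (node c L R)
  rib-left D (X , SX) (Y , mkHung P s e) = _ ,
    strip-beside D SX (piece-flip P) (pre-map tt s) (suf-map tt e)
    where open Embed flip-embed

  -- Turning the strip upside down exchanges its two ends, so a ribbon continuing behind `cb`
  -- becomes one continuing behind the first side of the mirrored tree. The hanging drawing is
  -- reversed to match the mirrored subtree.
  rib-right : {L : Tree a c} {R : Tree c b} → Dist (node c L R) →
    BSDrawing d L → RibDrawing d R → RibDrawing d (node c L R)
  rib-right {L = L} {R} D (Y , HY) (X , SX) = _ , strip-flip⁻ (node _ L R) (proj₂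
    (rib-left (dist-mirror (node _ L R) D) (_ , strip-flip SX) (_ , hung-rev HY)))

  fan-leaf : a ≢ b → FanDrawing d (leaf {a = a} {b = b})
  fan-leaf {a} {b} {d} a≢b = pole ∷ [] , record
    { piece = record
      { own = λ ¬o → abs (ok-home (¬o ∘ inj₁ ∘ sym)) (post-abs (¬o ∘ inj₂ ∘ inj₁)) ∷ []
      ; mid = λ ()
      ; drw = λ where
          base → inj₁ (here ve)
          base′ → inj₁ (here (vedge-sym ve)) }
    ; above = ◁-on (post-abs a≢b ∷ [])
    ; first = last (at (ok-home a≢b) post-at) [] }
    where
    open Embed (◁-embed (home a))
    pole : Col (suc (suc (room d)))
    pole = home a ◁ post b
    ve : VEdge a b pole
    ve = zero , suc zero , refl , refl , λ { zero _ → inj₁ refl ; (suc zero) _ → inj₂ refl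
                                           ; (suc (suc _)) _ → inj₂ refl }

  ◁-pre-vedge : {g : Grid (suc h)} → Pre zero b g → Drawn a b (map (home a ◁_) g)
  ◁-pre-vedge {b = b} {a} (last {col = col} p _) = inj₁ (here (zero , suc zero , refl , proj₁ p , lab))
    where
    lab : ∀ m → _ → label ((home a ◁ col) m) ≡ a ⊎ label ((home a ◁ col) m) ≡ b
    lab zero _ = inj₁ refl
    lab (suc zero) _ = inj₂ (cong label (proj₁ p))
    lab (suc (suc _)) (inj₁ (_ , s≤s ()))
    lab (suc (suc _)) (inj₂ (_ , ()))
  ◁-pre-vedge (p ∷ q) with ◁-pre-vedge q
  ... | inj₁ r = inj₁ (there r)
  ... | inj₂ r = inj₂ (Sum.map there there r)

  -- The fan grows to the left: the reversed hanging drawing ends with `c` in the second row, where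
  -- `c` of the older part begins, and starts with `b`, the next vertex to be prolonged. The edge
  -- `ab` needs no column of its own, because the first two rows are adjacent.
  fan-node : {L : Tree a c} {R : Tree c b} → Dist (node c L R) →
    FanDrawing d L → BSDrawing d R → FanDrawing d (node c L R)
  fan-node {a} {c} {b} {L = L} {R} D (X , mkFan PX on-a pre-c) (Y , HY) =
    map (home a ◁_) (rev Y) ++ X , record
    { piece = piece-⊆ bound (piece-mirror⁻ (node c L R) (piece-node _ X
        (piece-mirror PY) (piece-mirror PX)
        (λ i j → intR∉L L R D (mirror-int⁻ R i) j)
        (λ where
          i (inj₁ refl) → int≢start L (proj₁ D) (mirror-int⁻ L i)
          i (inj₂ j) → intL∉R L R D (mirror-int⁻ L i) j)
        (_ , suf-pre (suf-map (ok-home a≢c) (pre-rev (Hung.first HY))) pre-c)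
        (drawn-sym (drawn-++ˡ (◁-pre-vedge (suf-rev (Hung.final HY)))))))
    ; above = All.++⁺ (◁-on (all-rev (own (Hung.piece HY) a∉R))) on-a
    ; first = pre-off (pre-map (ok-home a≢b) (suf-rev (Hung.final HY)))
                (own PX (end∉left L R D)) }
    where
    open Embed (◁-embed (home a))
    a≢b : a ≢ b
    a≢b = ends-distinct (node c L R) D
    a≢c : a ≢ c
    a≢c = ends-distinct L (proj₁ D)
    a∉R : ¬ In a R
    a∉R = start∉right L R D
    PY : Piece (λ w → w ≡ a ⊎ In w R) R (map (home a ◁_) (rev Y))
    PY = piece-map (◁-embed (home a)) (a∉R ∘ inner) (piece-rev (Hung.piece HY))
    bound : ∀ {w} → (w ≡ a ⊎ In w R) ⊎ In w L → In w (node c L R)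
    bound (inj₁ (inj₁ refl)) = start
    bound (inj₁ (inj₂ i)) = in-right i
    bound (inj₂ i) = in-left i

  -- On an empty grid `On` holds vacuously; the `Suf` of some vertex certifies that there is a
  -- column.
  on⇒pre′ : Suf k x g → On zero w g → Pre zero w g
  on⇒pre′ (on _ _) (p ∷ ps) = on⇒pre p ps
  on⇒pre′ (_ ∷ _)  (p ∷ ps) = on⇒pre p ps

  on⇒suf′ : Suf k x g → On zero w g → Suf zero w g
  on⇒suf′ (on _ _) (p ∷ ps) = on p ps
  on⇒suf′ (_ ∷ _)  (p ∷ ps) = on p ps

  lp-leaf : a ≢ b → LPDrawing d (leaf {a = a} {b = b})
  lp-leaf a≢b = _ , strip-leaf a≢b , (bar-start a≢b ∷ [])

  lp-next : {L : Tree a c} {R : Tree c b} → Dist (node c L R) →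
    LPDrawing d L → BSDrawing d R → LPDrawing d (node c L R)
  lp-next {a} D (X , SX , on-a) (Y , mkHung P s e) = _ ,
    strip-beside D SX PY cY bY , beside-on D SX PY cY bY on-a
    where
    open Embed flip-embed
    module F = Embed (◁-embed (fill a))
    -- A side is two rows taller than the hanging drawing. One of them is the row of `a`; the other
    -- is spare and gets the label `a` without homes, which alters no segment.
    PY = piece-fill {x = a} (piece-flip P)
    cY = F.pre-map (λ ()) (pre-map tt s)
    bY = F.suf-map (λ ()) (suf-map tt e)

  -- The ribbon is drawn to the left of the fan, although it lies between the fan and b in the
  -- outerplanar embedding; b passes below the fan and a above everything.
  lp-turn : {L : Tree a c} {R : Tree c b} → Dist (node c L R) →
    FanDrawing d L → RibDrawing d R → LPDrawing d (node c L R)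
  lp-turn {a} {c} {b} {d} {L} {R} D (X , mkFan PX on-a pre-c) (Y , mkStrip P up lo) =
    A ++ (B ++ (bar a b ∷ [])) , record
    { piece = piece-⊆ bound (piece-mirror⁻ (node c L R) (piece-node A _
        (piece-mirror PA) (piece-mirror PB)
        (λ where
          i (inj₁ refl) → a∉R (inner (mirror-int⁻ R i))
          i (inj₂ (inj₁ refl)) → int≢end R (proj₁ (proj₂ D)) (mirror-int⁻ R i)
          i (inj₂ (inj₂ (inj₁ refl))) → int≢end R (proj₁ (proj₂ D)) (mirror-int⁻ R i)
          i (inj₂ (inj₂ (inj₂ j))) → intR∉L L R D (mirror-int⁻ R i) j)
        (λ where
          i (inj₁ refl) → int≢start L (proj₁ D) (mirror-int⁻ L i)
          i (inj₂ j) → intL∉R L R D (mirror-int⁻ L i) j)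
        -- With `a` put on top, the upper end `c` of the ribbon strip lies in the second row, the
        -- row in which `c` opens the fan strip.
        (_ , suf-pre (U.suf-map (ok-home a≢c) up)
               (pre-off (W.pre-map (ok-home (c≢b ∘ sym)) pre-c) (bar-abs (a≢c ∘ sym) c≢b ∷ [])))
        (drawn-sym (drawn-++ʳ A (drawn-++ʳ B (inj₁ (here bar-vedge)))))))
    ; upper = on⇒suf′ all-b all-a
    ; lower = all-b }
    , all-a
    where
    module U = Embed (◁-embed {suc (suc (room d))} (home a))
    module W = Embed (▷-embed {suc (suc (room d))} (home b))
    a≢b : a ≢ b
    a≢b = ends-distinct (node c L R) D
    a≢c : a ≢ c
    a≢c = ends-distinct L (proj₁ D)
    c≢b : c ≢ b
    c≢b = ends-distinct R (proj₁ (proj₂ D))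
    a∉R : ¬ In a R
    a∉R = start∉right L R D
    b∉L : ¬ In b L
    b∉L = end∉left L R D
    A B : Grid (suc (suc (suc (room d))))
    A = map (home a ◁_) Y
    B = map (_▷ home b) X
    PA : Piece (λ w → w ≡ a ⊎ In w R) R A
    PA = piece-map (◁-embed (home a)) (a∉R ∘ inner) P
    PB : Piece (λ w → w ≡ a ⊎ w ≡ b ⊎ w ≡ b ⊎ In w L) L (B ++ (bar a b ∷ []))
    PB = piece-bar (piece-map (▷-embed (home b)) (b∉L ∘ inner) PX)
           (int≢start L (proj₁ D)) (b∉L ∘ inner)
    all-b : Suf (fromℕ _) b (A ++ (B ++ (bar a b ∷ [])))
    all-b = suf-on (U.suf-map (ok-home a≢b) lo)
              (All.++⁺ (▷-on (own PX b∉L)) (bar-end a≢b ∷ []))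
    all-a : On zero a (A ++ (B ++ (bar a b ∷ [])))
    all-a = All.++⁺ (◁-on (own P a∉R))
              (All.++⁺ (W.on-map (ok-home (a≢b ∘ sym)) on-a) (bar-start a≢b ∷ []))
    bound : ∀ {w} → (w ≡ a ⊎ In w R) ⊎ (w ≡ a ⊎ w ≡ b ⊎ w ≡ b ⊎ In w L) → In w (node c L R)
    bound (inj₁ (inj₁ refl)) = start
    bound (inj₁ (inj₂ i)) = in-right i
    bound (inj₂ (inj₁ refl)) = start
    bound (inj₂ (inj₂ (inj₁ refl))) = end
    bound (inj₂ (inj₂ (inj₂ (inj₁ refl)))) = end
    bound (inj₂ (inj₂ (inj₂ (inj₂ i)))) = in-left i

  -- The two sides are placed face to face. Their last rows meet in `c`, and in the first row `a`
  -- stops just where `b` begins, so the cap becomes a horizontal edge.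
  bs-node : {L : Tree a c} {R : Tree c b} → Dist (node c L R) →
    LPDrawing d L → LPDrawing d (mirror R) → BSDrawing (suc d) (node c L R)
  bs-node {a} {c} {b} {L = L} {R} D (X , mkStrip PX aX cX , on-a) (Y , mkStrip PY bY cY , on-b) =
    X ++ rev Y , record
    { piece = piece-⊆ [ in-left , in-right ∘ mirror-in⁻ R ]
        (piece-node X (rev Y) PX (piece-mirror⁻ R (piece-rev PY))
          (λ i j → intL∉R L R D i (mirror-in⁻ R j)) (intR∉L L R D)
          (_ , suf-pre cX (suf-rev cY))
          (inj₂ (inj₁ (suf-pre-hedge aX (suf-rev bY)))))
    ; first = pre-off (on⇒pre′ aX on-a)
                (all-rev (own PY (start∉right L R D ∘ mirror-in⁻ R)))
    ; final = off-suf (own PX (end∉left L R D)) (pre-rev (on⇒pre′ bY on-b)) }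

  draw-BS  : {t : Tree a b} → Dist t → BS d t  → BSDrawing d t
  draw-LP  : {t : Tree a b} → Dist t → LP d t  → LPDrawing d t
  draw-Rib : {t : Tree a b} → Dist t → Rib d t → RibDrawing d t
  draw-Fan : {t : Tree a b} → Dist t → Fan d t → FanDrawing d t
  draw-BS D leaf = _ , hung-leaf D
  draw-BS D@(dL , dR , _) (node {R = R} l r) =
    bs-node D (draw-LP dL l) (draw-LP (dist-mirror R dR) r)
  draw-LP D leaf = lp-leaf D
  draw-LP D@(dL , dR , _) (next l s) = lp-next D (draw-LP dL l) (draw-BS dR s)
  draw-LP D@(dL , dR , _) (turn f r) = lp-turn D (draw-Fan dL f) (draw-Rib dR r)
  draw-Rib D leaf = _ , strip-leaf D
  draw-Rib D@(dL , dR , _) (left r s)  = rib-left D (draw-Rib dL r) (draw-BS dR s)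
  draw-Rib D@(dL , dR , _) (right s r) = rib-right D (draw-BS dL s) (draw-Rib dR r)
  draw-Fan D leaf = fan-leaf D
  draw-Fan D@(dL , dR , _) (node f s) = fan-node D (draw-Fan dL f) (draw-BS dR s)

  -- Segments read off a grid

  cell : Grid h → ℕ → Fin h → Maybe (Cell)
  cell []       _       _ = nothing
  cell (col ∷ _) zero    j = just (col j)
  cell (_ ∷ g)   (suc i) j = cell g i j

  IsSeg : Grid h → Fin N → Fin h × ℕ × ℕ → Set
  IsSeg g w (k , l , r) = l ≤ℕ r
    × (∀ {i} → l ≤ℕ i → i ≤ℕ r → cell g i k ≡ just (home w))
    × (∀ {i j} → cell g i j ≡ just (home w) → j ≡ k × l ≤ℕ i × i ≤ℕ r)

  off-cell : Off w g → ∀ i j → cell g i j ≢ just (home w)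
  off-cell [] _ _ ()
  off-cell (p ∷ ps) zero j e = p j (just-injective e)
  off-cell (p ∷ ps) (suc i) j e = off-cell ps i j e

  pre-seg : Pre k w g → ∃[ r ] IsSeg g w (k , 0 , r)
  pre-seg {k = k} {w} (last {col} {g} (p , q) o) = 0 , z≤n , (λ { _ z≤n → cong just p }) , bwd
    where
    bwd : ∀ {i j} → cell (col ∷ g) i j ≡ just (home w) → j ≡ k × 0 ≤ℕ i × i ≤ℕ 0
    bwd {zero} {j} e = q j (just-injective e) , z≤n , z≤n
    bwd {suc i} {j} e = contradiction e (off-cell o i j)
  pre-seg {k = k} {w} (_∷_ {col} {g} (p , q) ps) with pre-seg ps
  ... | r , _ , fwd , bwd = suc r , z≤n , fwd′ , bwd′
    where
    fwd′ : ∀ {i} → 0 ≤ℕ i → i ≤ℕ suc r → cell (col ∷ g) i k ≡ just (home w)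
    fwd′ {zero} _ _ = cong just p
    fwd′ {suc i} _ (s≤s le) = fwd z≤n le
    bwd′ : ∀ {i j} → cell (col ∷ g) i j ≡ just (home w) → j ≡ k × 0 ≤ℕ i × i ≤ℕ suc r
    bwd′ {zero} {j} e = q j (just-injective e) , z≤n , z≤n
    bwd′ {suc i} e with bwd e
    ... | p , _ , r = p , z≤n , s≤s r

  mid-seg : Mid k w g → ∃[ l ] ∃[ r ] IsSeg g w (k , l , r)
  mid-seg (pre p) = 0 , pre-seg p
  mid-seg {k = k} {w} (_∷_ {col} {g} p ps) with mid-seg ps
  ... | l , r , le , fwd , bwd = suc l , suc r , s≤s le , (λ { (s≤s p) (s≤s q) → fwd p q }) , bwd′
    where
    bwd′ : ∀ {i j} → cell (col ∷ g) i j ≡ just (home w) → j ≡ k × suc l ≤ℕ i × i ≤ℕ suc r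
    bwd′ {zero} {j} e = contradiction (just-injective e) (p j)
    bwd′ {suc i} e with bwd e
    ... | p , q , r = p , s≤s q , s≤s r

  -- Visibility representations from grids

  -- A drawn edge is described by its orientation (true: horizontal) and a column; a horizontal edge
  -- joins that column to the next one.
  IsHor IsVer : Grid h → Fin N → Fin N → ℕ → Set
  IsHor g u v i = ∃[ k ] (cell g i k ≡ just (home u) × cell g (suc i) k ≡ just (home v))
  IsVer g u v i = ∃[ j ] ∃[ k ] (cell g i j ≡ just (home u) × cell g i k ≡ just (home v)
    × (∀ m → Between j m k → ∃[ z ] (cell g i m ≡ just z × (label z ≡ u ⊎ label z ≡ v))))

  IsEdge : Grid h → Fin N → Fin N → Bool × ℕ → Set
  IsEdge g u v (true  , i) = IsHor g u v i ⊎ IsHor g v u i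
  IsEdge g u v (false , i) = IsVer g u v i

  isEdge-sym : ∀ p → IsEdge g u v p → IsEdge g v u p
  isEdge-sym (true , _) = Sum.swap
  isEdge-sym (false , _) (i , j , p , q , r) = j , i , q , p , λ m bt →
    let z , e , l = r m (Sum.swap bt) in z , e , Sum.swap l

  hedge-column : HEdge u v g → ∃[ i ] IsHor g u v i
  hedge-column (here k p q) = 0 , k , cong just p , cong just q
  hedge-column (there e) with hedge-column e
  ... | i , q = suc i , q

  vedge-column : Any (VEdge u v) g → ∃[ i ] IsVer g u v i
  vedge-column (here (i , j , p , q , r)) =
    0 , i , j , cong just p , cong just q , λ m bt → _ , refl , r m bt
  vedge-column (there e) with vedge-column e
  ... | i , q = suc i , q

  drawn-edge : Drawn u v g → ∃[ p ] IsEdge g u v p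
  drawn-edge (inj₁ e) = let i , p = vedge-column e in (false , i) , p
  drawn-edge (inj₂ (inj₁ e)) = let i , p = hedge-column e in (true , i) , inj₁ p
  drawn-edge (inj₂ (inj₂ e)) = let i , p = hedge-column e in (true , i) , inj₂ p


  _∈□_ : ℤ × ℤ → Box {N} → Set
  (X , Y) ∈□ box a b c d = (a ≤ℤ X × X ≤ℤ b) × (c ≤ℤ Y × Y ≤ℤ d)

  -- The larger of the lower coordinates works in each direction, provided that both boxes are
  -- nonempty. It turns the inequalities of `Meet` into an integer point, hence into a grid cell
  -- whose label can be inspected.
  meet-point : ∀ {x₁ x₂ y₁ y₂ x₁′ x₂′ y₁′ y₂′} →
    x₁ ≤ℤ x₂ → y₁ ≤ℤ y₂ → x₁′ ≤ℤ x₂′ → y₁′ ≤ℤ y₂′ →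
    Meet {N} (box x₁ x₂ y₁ y₂) (box x₁′ x₂′ y₁′ y₂′) →
    ∃[ p ] (p ∈□ box x₁ x₂ y₁ y₂ × p ∈□ box x₁′ x₂′ y₁′ y₂′)
  meet-point {x₁} {x₂} {y₁} {y₂} {x₁′} {x₂′} {y₁′} {y₂′} p q p′ q′ (i , j , k , l) =
    (x₁ ⊔ℤ x₁′ , y₁ ⊔ℤ y₁′) ,
    ((ℤ.i≤i⊔j x₁ x₁′ , ℤ.⊔-lub p j) , (ℤ.i≤i⊔j y₁ y₁′ , ℤ.⊔-lub q l)) ,
    ((ℤ.i≤j⊔i x₁ x₁′ , ℤ.⊔-lub i p′) , (ℤ.i≤j⊔i y₁ y₁′ , ℤ.⊔-lub k q′))

  module FromGrid (G : Graph N) {t : Tree a b} (T : IsTree G t) {h : ℕ} (g : Grid (suc h))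
    (segs : ∀ {w} → In w t → ∃[ k ] Mid k w g) (drawn : ∀ {x y} → Edge x y t → Drawn x y g) where

    -- Coloured p w: the grid point p carries the label w.  Distinct vertices cannot share a point.
    Coloured : ℤ × ℤ → Fin N → Set
    Coloured (X , Y) w = ∃[ i ] ∃[ j ] ∃[ z ]
      (X ≡ + i × Y ≡ + toℕ j × cell g i j ≡ just z × label z ≡ w)

    coloured-unique : ∀ {p} → Coloured p u → Coloured p w → u ≡ w
    coloured-unique (i , j , z , refl , refl , e , l) (i′ , j′ , z′ , p , q , e′ , l′)
      with ℤ.+-injective p | toℕ-injective (ℤ.+-injective q)
    ... | refl | refl with trans (sym e) e′
    ... | refl = trans (sym l) l′

    seg : ∀ w → Dec (In w t) → Fin (suc h) × ℕ × ℕ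
    seg w (yes i) = let k , m = segs i; l , r , _ = mid-seg m in k , l , r
    -- A dummy for vertices outside the tree; `isSeg` speaks of the others only.
    seg w (no _)  = zero , 0 , 0

    row : Fin N → Fin (suc h)
    row w = proj₁ (seg w (In? w t))

    lft rgt : Fin N → ℕ
    lft w = proj₁ (proj₂ (seg w (In? w t)))
    rgt w = proj₂ (proj₂ (seg w (In? w t)))

    isSeg : In w t → IsSeg g w (row w , lft w , rgt w)
    isSeg {w} i with In? w t
    ... | yes j = proj₂ (proj₂ (mid-seg (proj₂ (segs j))))
    ... | no ∉t = contradiction i ∉t

    Edge? : ∀ x y → Dec (Edge x y t)
    Edge? x y with E G x y in eq
    ... | true  = yes (A⇒E T eq)
    ... | false = no λ e → contradiction (trans (sym eq) (E⇒A T e)) λ ()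

    route₀ : ∀ x y → Dec (Edge x y t) → Bool × ℕ
    route₀ x y (yes e) = proj₁ (drawn-edge (drawn e))
    route₀ x y (no _)  = false , 0

    -- `drawn` may choose different drawings for `x y` and `y x`, whereas `hor` and `ex` must be
    -- symmetric. The order with the smaller vertex first decides.
    route : Fin N → Fin N → Bool × ℕ
    route x y with toℕ x ℕ.≤? toℕ y
    ... | yes _ = route₀ x y (Edge? x y)
    ... | no _  = route₀ y x (Edge? y x)

    route-sym : ∀ x y → route x y ≡ route y x
    route-sym x y with toℕ x ℕ.≤? toℕ y | toℕ y ℕ.≤? toℕ x
    ... | no _ | yes _ = refl
    ... | yes _ | no _ = refl
    ... | no p | no q = contradiction (ℕ.<⇒≤ (ℕ.≰⇒> p)) q
    ... | yes p | yes q with toℕ-injective (ℕ.≤-antisym p q)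
    ...   | refl = refl

    isEdge₀ : Edge x y t → (e? : Dec (Edge x y t)) → IsEdge g x y (route₀ x y e?)
    isEdge₀ e (yes e′) = proj₂ (drawn-edge (drawn e′))
    isEdge₀ e (no ¬e) = contradiction e ¬e

    isEdge : ∀ x y → Edge x y t → IsEdge g x y (route x y)
    isEdge x y e with toℕ x ℕ.≤? toℕ y
    ... | yes _ = isEdge₀ e (Edge? x y)
    ... | no _  = isEdge-sym (route₀ y x (Edge? y x)) (isEdge₀ (edge-sym e) (Edge? y x))

    Rep : FlatVisRep G
    Rep = record
      { y = λ w → + toℕ (row w) ; l = λ w → + lft w ; r = λ w → + rgt w
      ; hor = λ x y → proj₁ (route x y) ; ex = λ x y → + proj₂ (route x y) }

    -- A cell has one label: the run of `u` cannot enter column `suc i`, where `v` sits in the same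
    -- row, nor can the run of `v` reach back to column `i`. This identifies the ends from which
    -- `ebox` is computed.
    hor-position : u ≢ v → In u t → In v t → ∀ i → IsHor g u v i →
      row u ≡ row v × rgt u ≡ i × lft v ≡ suc i
    hor-position {u} {v} u≢v iu iv i (k , p , q) =
      trans (sym ku) kv , rgt≡ , lft≡
      where
      fwdu = proj₁ (proj₂ (isSeg iu))
      bwdu = proj₂ (proj₂ (isSeg iu)) p
      fwdv = proj₁ (proj₂ (isSeg iv))
      bwdv = proj₂ (proj₂ (isSeg iv)) q
      ku : k ≡ row u
      ku = proj₁ bwdu
      kv : k ≡ row v
      kv = proj₁ bwdv
      clash : ∀ {i} → cell g i (row u) ≡ just (home u) → cell g i (row v) ≡ just (home v) → ⊥
      clash {i} e e′ rewrite sym ku | sym kv =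
        u≢v (home-injective (just-injective (trans (sym e) e′)))
      rgt≡ : rgt u ≡ i
      rgt≡ with rgt u ℕ.≤? i
      ... | yes r≤i = ℕ.≤-antisym r≤i (proj₂ (proj₂ bwdu))
      ... | no r≰i = ⊥-elim (clash (fwdu (ℕ.m≤n⇒m≤1+n (proj₁ (proj₂ bwdu))) (ℕ.≰⇒> r≰i))
                       (subst (λ k → cell g (suc i) k ≡ just (home v)) kv q))
      lft≡ : lft v ≡ suc i
      lft≡ with suc i ℕ.≤? lft v
      ... | yes i<l = ℕ.≤-antisym (proj₁ (proj₂ bwdv)) i<l
      ... | no i≮l = ⊥-elim (clash (subst (λ k → cell g i k ≡ just (home u)) ku p)
                       (fwdv (ℕ.≤-pred (ℕ.≰⇒> i≮l)) (ℕ.<⇒≤ (proj₂ (proj₂ bwdv)))))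

    edge-ok : ∀ u v → Edge u v t → EdgeOK Rep u v
    edge-ok u v e with route u v in eq | isEdge u v e
    ... | true , i | inj₁ p with hor-position u≢v (edge-inˡ e) (edge-inʳ e) i p
      where u≢v = λ { refl → edge-irrefl t (dist T) e }
    ...   | rows , ru , lv = cong (λ k → + toℕ k) rows
                           , inj₁ (+<+ (subst₂ _<ℕ_ (sym ru) (sym lv) ℕ.≤-refl))
    edge-ok u v e | true , i | inj₂ p with hor-position v≢u (edge-inʳ e) (edge-inˡ e) i p
      where v≢u = λ { refl → edge-irrefl t (dist T) e }
    ...   | rows , ru , lv = cong (λ k → + toℕ k) (sym rows)
                           , inj₂ (+<+ (subst₂ _<ℕ_ (sym ru) (sym lv) ℕ.≤-refl))
    edge-ok u v e | false , i | (j , k , p , q , _)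
      with proj₂ (proj₂ (isSeg (edge-inˡ e))) p | proj₂ (proj₂ (isSeg (edge-inʳ e))) q
    ... | _ , l≤i , i≤r | _ , l≤i′ , i≤r′ rewrite cong proj₂ eq =
      (+≤+ l≤i , +≤+ i≤r) , (+≤+ l≤i′ , +≤+ i≤r′)

    vbox-coloured : ∀ {p} → In w t → p ∈□ vbox Rep w → Coloured p w
    vbox-coloured {w} i ((+≤+ l≤x , +≤+ x≤r) , (y₁ , y₂)) with ℤ.≤-antisym y₁ y₂
    ... | refl = _ , row w , _ , refl , refl , proj₁ (proj₂ (isSeg i)) l≤x x≤r , refl

    horBox : Fin N → Fin N → Box {N}
    horBox u v = box (+ (rgt u ⊓ rgt v)) (+ (lft u ⊔ lft v)) (+ toℕ (row u)) (+ toℕ (row u))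

    horBox-sym : ∀ u v → row u ≡ row v → horBox v u ≡ horBox u v
    horBox-sym u v e rewrite ℕ.⊓-comm (rgt v) (rgt u) | ℕ.⊔-comm (lft v) (lft u) | e = refl

    -- By `hor-position` the box covers just the columns `i` and `suc i`, that is, the last cell of
    -- `u` and the first of `v`.
    hor-coloured : ∀ {p} → u ≢ v → In u t → In v t → ∀ i → IsHor g u v i →
      p ∈□ horBox u v →
      Coloured p u ⊎ Coloured p v
    hor-coloured {u} {v} u≢v iu iv i H ((+≤+ {n = n} lo , +≤+ up) , (y₁ , y₂))
      with hor-position u≢v iu iv i H | ℤ.≤-antisym y₁ y₂
    ... | rows , ru , lv | refl with n ℕ.≤? i
    ...   | yes n≤i = inj₁ (_ , row u , _ , refl , refl
            , proj₁ (proj₂ (isSeg iu)) lu≤n (subst (n ≤ℕ_) (sym ru) n≤i) , refl)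
      where
      i≤rv : i ≤ℕ rgt v
      i≤rv = ℕ.<⇒≤ (subst (_≤ℕ rgt v) lv (proj₁ (isSeg iv)))
      i≤n : i ≤ℕ n
      i≤n = ℕ.≤-trans (ℕ.⊓-glb (ℕ.≤-reflexive (sym ru)) i≤rv) lo
      lu≤n : lft u ≤ℕ n
      lu≤n = ℕ.≤-trans (subst (lft u ≤ℕ_) ru (proj₁ (isSeg iu))) i≤n
    ...   | no n≰i = inj₂ (_ , row v , _ , refl , cong (λ k → + toℕ k) rows
            , proj₁ (proj₂ (isSeg iv)) (subst (_≤ℕ n) (sym lv) (ℕ.≰⇒> n≰i))
                (ℕ.≤-trans n≤lv (proj₁ (isSeg iv))) , refl)
      where
      lu≤lv : lft u ≤ℕ lft v
      lu≤lv = ℕ.≤-trans (proj₁ (isSeg iu)) (subst₂ _≤ℕ_ (sym ru) (sym lv) (ℕ.n≤1+n i))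
      n≤lv : n ≤ℕ lft v
      n≤lv = ℕ.≤-trans up (ℕ.⊔-lub lu≤lv ℕ.≤-refl)

    between : ∀ {n} (j k : Fin (suc h)) → toℕ j ⊓ toℕ k ≤ℕ n → n ≤ℕ toℕ j ⊔ toℕ k →
      ∃[ m ] (n ≡ toℕ m × Between j m k)
    between {n} j k lo up with ℕ.≤-total (toℕ j) (toℕ k)
    ... | inj₁ j≤k = fromℕ< n<h , sym (toℕ-fromℕ< n<h) ,
        inj₁ ( subst (toℕ j ≤ℕ_) (sym (toℕ-fromℕ< n<h)) (subst (_≤ℕ n) (ℕ.m≤n⇒m⊓n≡m j≤k) lo)
             , subst (_≤ℕ toℕ k) (sym (toℕ-fromℕ< n<h)) n≤k)
      where
      n≤k = subst (n ≤ℕ_) (ℕ.m≤n⇒m⊔n≡n j≤k) up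
      n<h = ℕ.≤-<-trans n≤k (toℕ<n k)
    ... | inj₂ k≤j = fromℕ< n<h , sym (toℕ-fromℕ< n<h) ,
        inj₂ ( subst (toℕ k ≤ℕ_) (sym (toℕ-fromℕ< n<h)) (subst (_≤ℕ n) (ℕ.m≥n⇒m⊓n≡n k≤j) lo)
             , subst (_≤ℕ toℕ j) (sym (toℕ-fromℕ< n<h)) n≤j)
      where
      n≤j = subst (n ≤ℕ_) (ℕ.m≥n⇒m⊔n≡m k≤j) up
      n<h = ℕ.≤-<-trans n≤j (toℕ<n j)

    ver-coloured : ∀ {p} → In u t → In v t → ∀ i → IsVer g u v i →
      p ∈□ box (+ i) (+ i) (+ (toℕ (row u) ⊓ toℕ (row v))) (+ (toℕ (row u) ⊔ toℕ (row v))) →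
      Coloured p u ⊎ Coloured p v
    ver-coloured iu iv i (j , k , p , q , lab) ((x₁ , x₂) , (+≤+ lo , +≤+ up))
      with ℤ.≤-antisym x₁ x₂ | proj₁ (proj₂ (proj₂ (isSeg iu)) p) | proj₁ (proj₂ (proj₂ (isSeg iv)) q)
    ... | refl | refl | refl with between j k lo up
    ... | m , refl , bt with lab m bt
    ... | z , e , l = Sum.map (λ l → i , m , z , refl , refl , e , l)
                              (λ l → i , m , z , refl , refl , e , l) l

    Nonempty : Box {N} → Set
    Nonempty (box x₁ x₂ y₁ y₂) = x₁ ≤ℤ x₂ × y₁ ≤ℤ y₂

    hor-nonempty : u ≢ v → In u t → In v t → ∀ i → IsHor g u v i → Nonempty (horBox u v)
    hor-nonempty {u} {v} u≢v iu iv i H with hor-position u≢v iu iv i H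
    ... | _ , ru , lv = +≤+ (ℕ.≤-trans (ℕ.m⊓n≤m (rgt u) (rgt v))
        (ℕ.≤-trans (subst₂ _≤ℕ_ (sym ru) (sym lv) (ℕ.n≤1+n i)) (ℕ.m≤n⊔m (lft u) (lft v))))
        , ℤ.≤-refl

    Spec : Fin N → Fin N → Box {N} → Set
    Spec u v B = Nonempty B × (∀ {p} → p ∈□ B → Coloured p u ⊎ Coloured p v)

    hor-spec : Edge u v t → ∀ i → IsHor g u v i → Spec u v (horBox u v)
    hor-spec e i H = hor-nonempty u≢v (edge-inˡ e) (edge-inʳ e) i H
                   , hor-coloured u≢v (edge-inˡ e) (edge-inʳ e) i H
      where u≢v = λ { refl → edge-irrefl t (dist T) e }

    ebox-spec : ∀ u v → Edge u v t → Spec u v (ebox Rep u v)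
    ebox-spec u v e with route u v | isEdge u v e
    ... | true , i | inj₁ H = hor-spec e i H
    ... | true , i | inj₂ H = subst (Spec u v) (horBox-sym u v (sym rows)) (ne , Sum.swap ∘ dye)
      where
      S = hor-spec (edge-sym e) i H
      ne = proj₁ S
      dye = λ {p} → proj₂ S {p}
      rows = proj₁ (hor-position (λ { refl → edge-irrefl t (dist T) e }) (edge-inʳ e) (edge-inˡ e) i H)
    ... | false , i | H =
      (ℤ.≤-refl , +≤+ (ℕ.≤-trans (ℕ.m⊓n≤m (toℕ (row u)) (toℕ (row v)))
                                 (ℕ.m≤m⊔n (toℕ (row u)) (toℕ (row v)))))
      , ver-coloured (edge-inˡ e) (edge-inʳ e) i H

    planar : IsPlanarFlatVis Rep
    planar =
        (λ w i → +≤+ (proj₁ (isSeg (V⇒In T i))))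
      , (λ u v → cong proj₁ (route-sym u v))
      , (λ u v → cong (λ p → + proj₂ p) (route-sym u v))
      , (λ u v e → edge-ok u v (A⇒E T e))
      , (λ u w iu iw u≢w m →
          let p , pu , pw = meet-point (proj₁ (vbox-ne iu)) ℤ.≤-refl (proj₁ (vbox-ne iw)) ℤ.≤-refl m
          in u≢w (coloured-unique (vbox-coloured (V⇒In T iu) pu) (vbox-coloured (V⇒In T iw) pw)))
      , (λ w u v iw e w≢u w≢v m →
          let ne , dye = ebox-spec u v (A⇒E T e)
              p , pw , pe = meet-point (proj₁ (vbox-ne iw)) ℤ.≤-refl (proj₁ ne) (proj₂ ne) m
              cw = vbox-coloured (V⇒In T iw) pw
          in [ w≢u ∘ coloured-unique cw , w≢v ∘ coloured-unique cw ] (dye pe))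
      , (λ u v x y e e′ u≢x u≢y v≢x v≢y m →
          let ne , dye = ebox-spec u v (A⇒E T e)
              ne′ , dye′ = ebox-spec x y (A⇒E T e′)
              p , pe , pe′ = meet-point (proj₁ ne) (proj₂ ne) (proj₁ ne′) (proj₂ ne′) m
          in [ (λ cu → [ u≢x ∘ coloured-unique cu , u≢y ∘ coloured-unique cu ] (dye′ pe′))
             , (λ cv → [ v≢x ∘ coloured-unique cv , v≢y ∘ coloured-unique cv ] (dye′ pe′)) ] (dye pe))
      where
      vbox-ne : w ∈V G → Nonempty (vbox Rep w)
      vbox-ne i = +≤+ (proj₁ (isSeg (V⇒In T i))) , ℤ.≤-refl

    height : HeightAtMost Rep (suc h)
    height = map +_ (upTo (suc h))
           , ℕ.≤-reflexive (trans (length-map +_ (upTo (suc h))) (length-upTo (suc h)))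
           , λ where
               k (inj₁ (w , _ , refl)) → layer (row w)
               k (inj₂ (u , v , e , lo , up)) →
                 let ne , dye = ebox-spec u v (A⇒E T e)
                 -- A layer meeting an edge contains the point of it at the left end of its box, and
                 -- that point is a cell of the grid.
                 in [ coloured-layer , coloured-layer ] (dye ((ℤ.≤-refl , proj₁ ne) , (lo , up)))
      where
      layer : (j : Fin (suc h)) → + toℕ j ∈ map +_ (upTo (suc h))
      layer j = ∈-map⁺ +_ (∈-upTo⁺ (toℕ<n j))
      coloured-layer : ∀ {X k} → Coloured (X , k) w → k ∈ map +_ (upTo (suc h))
      coloured-layer (_ , j , _ , _ , refl , _) = layer j

  room≡ : ∀ d → suc (room d) ≡ 2 * d + 1
  room≡ zero = refl
  room≡ (suc d) rewrite ℕ.+-suc d (d + 0) = cong (λ n → suc (suc n)) (room≡ d)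

  hung-seg : {t : Tree a b} {g : Grid (suc h)} → Hung t g →
             ∀ {w} → In w t → ∃[ k ] Mid k w g
  hung-seg (mkHung P f l) start     = zero , pre f
  hung-seg (mkHung P f l) end       = zero , suf⇒mid l
  hung-seg (mkHung P f l) (inner i) = Piece.mid P i

  BS⇒drawing : ∀ {G : Graph N} {t : Tree a b} → IsTree G t → ∀ d → BS d t →
    Σ (FlatVisRep G) λ R → IsPlanarFlatVis R × HeightAtMost R (2 * d + 1)
  BS⇒drawing {G = G} T d s =
    let g , H = draw-BS (dist T) s
        open FromGrid G T g (hung-seg H) (Piece.drw (Hung.piece H))
    in Rep , planar , subst (HeightAtMost Rep) (room≡ d) height

  -- Triangulating maximal outerplanar graphs

  Adj? : (G : Graph N) → ∀ x y → Dec (Adj G x y)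
  Adj? G x y with E G x y
  ... | true  = yes refl
  ... | false = no λ ()

  module Triangulation {G : Graph N} (S : Simple G) {k : ℕ} (M : MOPEmbedding G k) where
    open MOPEmbedding M

    _~_ : Fin k → Fin k → Set
    i ~ j = Adj G (ord i) (ord j)

    ~-sym : ∀ {i j} → i ~ j → j ~ i
    ~-sym = proj₁ S _ _

    -- The largest neighbour j < l of i; its edge to l closes the triangle on the chord il.
    search : ∀ {i l : Fin k} → suc (toℕ i) <ℕ toℕ l → ∀ m → m ≤ℕ toℕ l →
      (∀ j → m ≤ℕ toℕ j → toℕ j <ℕ toℕ l → ¬ i ~ j) →
      ∃[ j ] (toℕ i <ℕ toℕ j × toℕ j <ℕ toℕ l × i ~ j
            × (∀ j′ → toℕ j <ℕ toℕ j′ → toℕ j′ <ℕ toℕ l → ¬ i ~ j′))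
    search {i} {l} i+1<l m m≤l none = go m m≤l none
      where
      next<k : suc (toℕ i) <ℕ k
      next<k = ℕ.<-trans i+1<l (toℕ<n l)
      after : Fin k
      after = fromℕ< next<k
      next≡ : toℕ after ≡ suc (toℕ i)
      next≡ = toℕ-fromℕ< next<k
      stop : ∀ {m} → m ≤ℕ suc (toℕ i) →
        ¬ (∀ j → m ≤ℕ toℕ j → toℕ j <ℕ toℕ l → ¬ i ~ j)
      stop m≤ none = none after (subst (_ ≤ℕ_) (sym next≡) m≤)
        (subst (_<ℕ toℕ l) (sym next≡) i+1<l) (cyc-step i after next≡)
      position : ∀ {m} → m <ℕ toℕ l → ∃[ j ] toℕ {k} j ≡ m
      position m<l = fromℕ< (ℕ.<-trans m<l (toℕ<n l)) , toℕ-fromℕ< _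
      go : ∀ m → m ≤ℕ toℕ l → (∀ j → m ≤ℕ toℕ j → toℕ j <ℕ toℕ l → ¬ i ~ j) → _
      go zero _ none = contradiction none (stop z≤n)
      go (suc m) m<l none with suc (toℕ i) ℕ.≤? m | position m<l
      ... | no i≮m | _ = contradiction none (stop (ℕ.≰⇒> i≮m))
      ... | yes i<m | j , j≡m with Adj? G (ord i) (ord j)
      ...   | yes i~j = j , subst (toℕ i <ℕ_) (sym j≡m) i<m , subst (_<ℕ toℕ l) (sym j≡m) m<l
                      , i~j , λ j′ j<j′ → none j′ (subst (_<ℕ toℕ j′) j≡m j<j′)
      ...   | no i≁j = go m (ℕ.<⇒≤ m<l) none′
        where
        none′ : ∀ j′ → m ≤ℕ toℕ j′ → toℕ j′ <ℕ toℕ l → ¬ i ~ j′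
        none′ j′ m≤j′ j′<l i~j′ with ℕ.m≤n⇒m<n∨m≡n m≤j′
        ... | inj₁ m<j′ = none j′ m<j′ j′<l i~j′
        ... | inj₂ m≡j′ = i≁j (subst (i ~_) (sym (toℕ-injective (trans j≡m m≡j′))) i~j′)

    -- Take the largest neighbour `j` of `i` before `l`. If `j` and `l` were not adjacent, some edge
    -- `pm` would separate them. With `m` beyond `l` or before `i` it crosses `il`; with `m` between
    -- `i` and `j` it crosses `ij`; and `m` equal to `i` makes `p` a larger neighbour.
    apex : ∀ {i l} → suc (toℕ i) <ℕ toℕ l → i ~ l →
      ∃[ j ] (toℕ i <ℕ toℕ j × toℕ j <ℕ toℕ l × i ~ j × j ~ l)
    apex {i} {l} i+1<l i~l
      with search i+1<l (toℕ l) ℕ.≤-refl (λ j l≤j j<l _ → ℕ.<⇒≱ j<l l≤j)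
    ... | j , i<j , j<l , i~j , maximal with Adj? G (ord j) (ord l)
    ...   | yes j~l = j , i<j , j<l , i~j , j~l
    ...   | no j≁l with triang j l j<l j≁l
    ...     | p , m , j<p , p<l , side , p~m = ⊥-elim (out side)
      where
      out : toℕ m <ℕ toℕ j ⊎ toℕ l <ℕ toℕ m → ⊥
      out (inj₂ l<m) = noncross i p l m (ℕ.<-trans i<j j<p) p<l l<m (i~l , p~m)
      out (inj₁ m<j) with ℕ.<-cmp (toℕ i) (toℕ m)
      ... | tri< i<m _ _ = noncross i m j p i<m m<j j<p (i~j , ~-sym p~m)
      ... | tri> _ _ m<i = noncross m i p l m<i (ℕ.<-trans i<j j<p) p<l (~-sym p~m , i~l)
      ... | tri≈ _ i≡m _ with toℕ-injective i≡m
      ...   | refl = maximal p j<p p<l (~-sym p~m)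

    record Spans (i l : Fin k) (t : Tree (ord i) (ord l)) : Set where
      field
        in⇒ : In x t → ∃[ j ] (x ≡ ord j × toℕ i ≤ℕ toℕ j × toℕ j ≤ℕ toℕ l)
        ⇒in : ∀ j → toℕ i ≤ℕ toℕ j → toℕ j ≤ℕ toℕ l → In (ord j) t
        e⇒  : Edge x y t → Adj G x y
        ⇒e  : ∀ j m → toℕ i ≤ℕ toℕ j → toℕ j ≤ℕ toℕ l → toℕ i ≤ℕ toℕ m → toℕ m ≤ℕ toℕ l →
              j ~ m → Edge (ord j) (ord m) t
        dis : Dist t
    open Spans

    spans-leaf : ∀ i l → suc (toℕ i) ≡ toℕ l → i ~ l → Spans i l leaf
    spans-leaf i l i+1≡l i~l = record
      { in⇒ = λ { start → i , refl , ℕ.≤-refl , i≤l ; end → l , refl , i≤l , ℕ.≤-refl }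
      ; ⇒in = λ j p q → [ (λ { refl → start }) , (λ { refl → end }) ] (ends j p q)
      ; e⇒ = λ { base → i~l ; base′ → ~-sym i~l }
      ; ⇒e = λ j m p q r s e → edge (ends j p q) (ends m r s) e
      ; dis = λ e → proj₁ (proj₂ S) (ord i) (subst (Adj G (ord i)) (sym e) i~l) }
      where
      i≤l : toℕ i ≤ℕ toℕ l
      i≤l = subst (toℕ i ≤ℕ_) i+1≡l (ℕ.n≤1+n (toℕ i))
      ends : ∀ j → toℕ i ≤ℕ toℕ j → toℕ j ≤ℕ toℕ l → j ≡ i ⊎ j ≡ l
      ends j p q with ℕ.m≤n⇒m<n∨m≡n p
      ... | inj₂ i≡j = inj₁ (sym (toℕ-injective i≡j))
      ... | inj₁ i<j = inj₂ (toℕ-injective (ℕ.≤-antisym q (subst (_≤ℕ toℕ j) i+1≡l i<j)))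
      edge : ∀ {j m} → j ≡ i ⊎ j ≡ l → m ≡ i ⊎ m ≡ l → j ~ m → Edge (ord j) (ord m) (leaf {a = ord i} {b = ord l})
      edge (inj₁ refl) (inj₁ refl) e = contradiction e (proj₁ (proj₂ S) _)
      edge (inj₁ refl) (inj₂ refl) e = base
      edge (inj₂ refl) (inj₁ refl) e = base′
      edge (inj₂ refl) (inj₂ refl) e = contradiction e (proj₁ (proj₂ S) _)

    spans-node : ∀ {i j l} {L : Tree (ord i) (ord j)} {R : Tree (ord j) (ord l)} →
      toℕ i <ℕ toℕ j → toℕ j <ℕ toℕ l → i ~ l → i ~ j → j ~ l →
      Spans i j L → Spans j l R → Spans i l (node (ord j) L R)
    spans-node {i} {j} {l} {L} {R} i<j j<l i~l i~j j~l SL SR = record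
      { in⇒ = λ x → [ (λ p → let m , e , lo , up = in⇒ SL p in m , e , lo , ℕ.≤-trans up (ℕ.<⇒≤ j<l))
                    , (λ p → let m , e , lo , up = in⇒ SR p in m , e , ℕ.≤-trans (ℕ.<⇒≤ i<j) lo , up)
                    ] (in-node x)
      ; ⇒in = λ m p q → [ (λ m≤j → in-left (⇒in SL m p m≤j)) , (λ j≤m → in-right (⇒in SR m j≤m q)) ]
                          (ℕ.≤-total (toℕ m) (toℕ j))
      ; e⇒ = λ { base → i~l ; base′ → ~-sym i~l ; (inl e) → e⇒ SL e ; (inr e) → e⇒ SR e }
      ; ⇒e = edge
      ; dis = dis SL , dis SR , shared }
      where
      shared : ∀ {x} → In x L → In x R → x ≡ ord j
      shared p q with in⇒ SL p | in⇒ SR q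
      ... | m , refl , _ , m≤j | m′ , e , j≤m′ , _ with ord-inj m m′ e
      ...   | refl = cong ord (toℕ-injective (ℕ.≤-antisym m≤j j≤m′))
      -- An edge passing over `j` crosses `ij` or `jl` unless it starts at `i` and ends at `l`.
      across : ∀ p q → toℕ i ≤ℕ toℕ p → toℕ p <ℕ toℕ j → toℕ j <ℕ toℕ q → toℕ q ≤ℕ toℕ l → p ~ q →
        p ≡ i × q ≡ l
      across p q i≤p p<j j<q q≤l p~q with ℕ.m≤n⇒m<n∨m≡n i≤p
      ... | inj₁ i<p = contradiction (i~j , p~q) (noncross i p j q i<p p<j j<q)
      ... | inj₂ i≡p with toℕ-injective i≡p | ℕ.m≤n⇒m<n∨m≡n q≤l
      ...   | refl | inj₁ q<l = contradiction (p~q , j~l) (noncross i j q l i<j j<q q<l)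
      ...   | refl | inj₂ q≡l = refl , toℕ-injective q≡l
      edge : ∀ p q → toℕ i ≤ℕ toℕ p → toℕ p ≤ℕ toℕ l → toℕ i ≤ℕ toℕ q → toℕ q ≤ℕ toℕ l → p ~ q →
        Edge (ord p) (ord q) (node (ord j) L R)
      edge p q i≤p p≤l i≤q q≤l e with toℕ p ℕ.≤? toℕ j | toℕ q ℕ.≤? toℕ j
      ... | yes p≤j | yes q≤j = inl (⇒e SL p q i≤p p≤j i≤q q≤j e)
      ... | no p≰j | no q≰j =
        inr (⇒e SR p q (ℕ.<⇒≤ (ℕ.≰⇒> p≰j)) p≤l (ℕ.<⇒≤ (ℕ.≰⇒> q≰j)) q≤l e)
      ... | yes p≤j | no q≰j with ℕ.m≤n⇒m<n∨m≡n p≤j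
      ...   | inj₂ p≡j = inr (⇒e SR p q (ℕ.≤-reflexive (sym p≡j)) p≤l (ℕ.<⇒≤ (ℕ.≰⇒> q≰j)) q≤l e)
      ...   | inj₁ p<j with across p q i≤p p<j (ℕ.≰⇒> q≰j) q≤l e
      ...     | refl , refl = base
      edge p q i≤p p≤l i≤q q≤l e | no p≰j | yes q≤j with ℕ.m≤n⇒m<n∨m≡n q≤j
      ...   | inj₂ q≡j = inr (⇒e SR p q (ℕ.<⇒≤ (ℕ.≰⇒> p≰j)) p≤l (ℕ.≤-reflexive (sym q≡j)) q≤l e)
      ...   | inj₁ q<j with across q p i≤q q<j (ℕ.≰⇒> p≰j) p≤l (~-sym e)
      ...     | refl , refl = base′

    -- The number `n` bounds the distance from `i` to `l`; the apex lies strictly between them, so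
    -- both halves are shorter.
    triangulate : ∀ n i l → toℕ i <ℕ toℕ l → toℕ l ≤ℕ n + toℕ i → i ~ l → Σ (Tree (ord i) (ord l)) (Spans i l)
    triangulate zero i l i<l le i~l = contradiction le (ℕ.<⇒≱ i<l)
    triangulate (suc n) i l i<l le i~l with ℕ.m≤n⇒m<n∨m≡n i<l
    ... | inj₂ i+1≡l = leaf , spans-leaf i l i+1≡l i~l
    ... | inj₁ i+1<l with apex i+1<l i~l
    ...   | j , i<j , j<l , i~j , j~l
      with triangulate n i j i<j (ℕ.≤-pred (ℕ.≤-trans j<l le)) i~j
         | triangulate n j l j<l (ℕ.≤-trans le (subst (_≤ℕ n + toℕ j) (ℕ.+-suc n (toℕ i)) (ℕ.+-monoʳ-≤ n i<j))) j~l
    ...   | L , SL | R , SR = node (ord j) L R , spans-node i<j j<l i~l i~j j~l SL SR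

  Triangulated : Graph N → Set
  Triangulated G = ∃[ a ] ∃[ b ] Σ (Tree a b) λ t → IsTree G t × ∃[ x ] Int x t

  triangulated : {G : Graph N} → MaxOuterplanar G → Triangulated G
  triangulated {G} (S , suc (suc (suc k)) , s≤s (s≤s (s≤s z≤n)) , M)
    -- The root is the edge closing the outer cycle; having at least three vertices puts the second
    -- one strictly behind it.
    with triangulate (suc (suc k)) zero (fromℕ (suc (suc k))) (s≤s z≤n)
           (ℕ.≤-trans (ℕ.≤-reflexive (toℕ-fromℕ (suc (suc k)))) (ℕ.m≤m+n _ 0))
           (MOPEmbedding.cyc-close M zero (fromℕ (suc (suc k))) refl (toℕ-fromℕ (suc (suc k))))
    where open Triangulation S M
  ... | t , Sp = _ , _ , t , record
    { V⇒In = λ {x} p → in′ (ord-onto x p)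
    ; In⇒V = λ p → let j , e , _ = in⇒ p in subst (_∈V G) (sym e) (ord-in j)
    ; A⇒E  = λ {x} {y} e → let p , q = proj₂ (proj₂ S) x y e in edge (ord-onto x p) (ord-onto y q) e
    ; E⇒A  = e⇒
    ; dist = dis } , ord (suc zero) , int (⇒in (suc zero) z≤n (s≤s z≤n))
    where
    open MOPEmbedding M
    open Triangulation S M
    open Spans Sp
    up : ∀ j → toℕ j ≤ℕ toℕ (fromℕ (suc (suc k)))
    up j = subst (toℕ j ≤ℕ_) (sym (toℕ-fromℕ (suc (suc k)))) (ℕ.≤-pred (toℕ<n j))
    in′ : ∀ {x} → ∃[ i ] ord i ≡ x → In x t
    in′ (j , refl) = ⇒in j z≤n (up j)
    edge : ∀ {x y} → ∃[ i ] ord i ≡ x → ∃[ i ] ord i ≡ y → Adj G x y → Edge x y t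
    edge (j , refl) (m , refl) = ⇒e j m z≤n (up j) z≤n (up m)
    int : In (ord (suc zero)) t → Int (ord (suc zero)) t
    int (inj₁ e) = contradiction (ord-inj _ _ e) λ ()
    int (inj₂ (inj₁ e)) = contradiction (ord-inj _ _ e) λ ()
    int (inner i) = i

  -- Re-rooting at a non-cutting edge

  -- G consists of two polygons s and o glued along ab; walking into s moves the gluing edge until it
  -- reaches the wanted root edge.
  record Glued (G : Graph N) (s : Tree a b) (o : Tree b a) : Set where
    field
      V⇒In : x ∈V G → In x s ⊎ In x o
      In⇒V : In x s ⊎ In x o → x ∈V G
      A⇒E  : Adj G x y → Edge x y s ⊎ Edge x y o
      E⇒A  : Edge x y s ⊎ Edge x y o → Adj G x y
      dist-s : Dist s
      dist-o : Dist o
      apart  : In x s → In x o → x ≡ a ⊎ x ≡ b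

  module _ {G : Graph N} where
    open Glued

    glued-swap : {s : Tree a b} {o : Tree b a} → Glued G s o → Glued G o s
    glued-swap g = record
      { V⇒In = Sum.swap ∘ V⇒In g ; In⇒V = In⇒V g ∘ Sum.swap
      ; A⇒E = Sum.swap ∘ A⇒E g ; E⇒A = E⇒A g ∘ Sum.swap
      ; dist-s = dist-o g ; dist-o = dist-s g ; apart = λ p q → Sum.swap (apart g q p) }

    glued-left : ∀ {c} {L : Tree a c} {R : Tree c b} {o : Tree b a} →
      Glued G (node c L R) o → Glued G L (node b R o)
    glued-left {a} {b} {c} {L} {R} {o} g = record
      { V⇒In = λ x → [ [ inj₁ , inj₂ ∘ in-left ] ∘ in-node , inj₂ ∘ in-right ] (V⇒In g x)
      ; In⇒V = [ In⇒V g ∘ inj₁ ∘ in-left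
               , [ In⇒V g ∘ inj₁ ∘ in-right , In⇒V g ∘ inj₂ ] ∘ in-node ]
      ; A⇒E = λ e → [ (λ { base → inj₂ (inr base′) ; base′ → inj₂ (inr base)
                         ; (inl e) → inj₁ e ; (inr e) → inj₂ (inl e) })
                    , inj₂ ∘ inr ] (A⇒E g e)
      ; E⇒A = λ where
          (inj₁ e) → E⇒A g (inj₁ (inl e))
          (inj₂ base) → E⇒A g (inj₁ (inl base′))
          (inj₂ base′) → E⇒A g (inj₁ (inl base))
          (inj₂ (inl e)) → E⇒A g (inj₁ (inr e))
          (inj₂ (inr e)) → E⇒A g (inj₂ e)
      ; dist-s = proj₁ D
      ; dist-o = proj₁ (proj₂ D) , dist-o g , λ i j → R∩o i (apart g (in-right i) j)
      ; apart = λ i j → [ inj₂ ∘ proj₂ (proj₂ D) i , (λ j → L∩o i (apart g (in-left i) j)) ] (in-node j) }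
      where
      D = dist-s g
      R∩o : ∀ {x} → In x R → x ≡ a ⊎ x ≡ b → x ≡ b
      R∩o i (inj₁ refl) = contradiction i (start∉right L R D)
      R∩o i (inj₂ e) = e
      L∩o : ∀ {x} → In x L → x ≡ a ⊎ x ≡ b → x ≡ a ⊎ x ≡ c
      L∩o i (inj₁ e) = inj₁ e
      L∩o i (inj₂ refl) = contradiction i (end∉left L R D)

    glued-right : ∀ {c} {L : Tree a c} {R : Tree c b} {o : Tree b a} →
      Glued G (node c L R) o → Glued G R (node a o L)
    glued-right {a} {b} {c} {L} {R} {o} g = record
      { V⇒In = λ x → [ [ inj₂ ∘ in-right , inj₁ ] ∘ in-node , inj₂ ∘ in-left ] (V⇒In g x)
      ; In⇒V = [ In⇒V g ∘ inj₁ ∘ in-right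
               , [ In⇒V g ∘ inj₂ , In⇒V g ∘ inj₁ ∘ in-left ] ∘ in-node ]
      ; A⇒E = λ e → [ (λ { base → inj₂ (inl base′) ; base′ → inj₂ (inl base)
                         ; (inl e) → inj₂ (inr e) ; (inr e) → inj₁ e })
                    , inj₂ ∘ inl ] (A⇒E g e)
      ; E⇒A = λ where
          (inj₁ e) → E⇒A g (inj₁ (inr e))
          (inj₂ base) → E⇒A g (inj₁ (inr base′))
          (inj₂ base′) → E⇒A g (inj₁ (inr base))
          (inj₂ (inl e)) → E⇒A g (inj₂ e)
          (inj₂ (inr e)) → E⇒A g (inj₁ (inl e))
      ; dist-s = proj₁ (proj₂ D)
      ; dist-o = dist-o g , proj₁ D , λ i j → o∩L j (apart g (in-left j) i)
      ; apart = λ i j → [ (λ j → R∩o i (apart g (in-right i) j)) , (λ j → inj₁ (proj₂ (proj₂ D) j i)) ] (in-node j) }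
      where
      D = dist-s g
      o∩L : ∀ {x} → In x L → x ≡ a ⊎ x ≡ b → x ≡ a
      o∩L i (inj₁ e) = e
      o∩L i (inj₂ refl) = contradiction i (end∉left L R D)
      R∩o : ∀ {x} → In x R → x ≡ a ⊎ x ≡ b → x ≡ c ⊎ x ≡ b
      R∩o i (inj₁ refl) = contradiction i (start∉right L R D)
      R∩o i (inj₂ e) = inj₂ e

    glued-leaf : {s : Tree a b} → Glued G s leaf → IsTree G s
    glued-leaf g = record
      { V⇒In = [ id , (λ { start → end ; end → start }) ] ∘ V⇒In g
      ; In⇒V = In⇒V g ∘ inj₁
      ; A⇒E  = [ id , (λ { base → base′ ; base′ → base }) ] ∘ A⇒E g
      ; E⇒A  = E⇒A g ∘ inj₁
      ; dist = dist-s g }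

    glued-reach : {s : Tree a b} {o : Tree b a} → Glued G s o →
      Int x s → Reach G a b x y → Int y s
    glued-reach g i (here _) = i
    glued-reach {s = s} g i (step r e (_ , z≢a , z≢b)) with glued-reach g i r
    ... | j with A⇒E g e
    ...   | inj₂ e′ with apart g (inner j) (edge-inˡ e′)
    ...     | inj₁ refl = contradiction j (int≢start s (dist-s g))
    ...     | inj₂ refl = contradiction j (int≢end s (dist-s g))
    glued-reach g i (step r e (_ , z≢a , z≢b)) | j | inj₁ e′ with edge-inʳ e′
    ... | inj₁ p = contradiction p z≢a
    ... | inj₂ (inj₁ p) = contradiction p z≢b
    ... | inner i′ = i′

    int-minus : {s : Tree a b} {o : Tree b a} → Glued G s o → Int x s → InMinus G a b x
    int-minus {s = s} g i = In⇒V g (inj₁ (inner i))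
      , (λ { refl → int≢start s (dist-s g) i }) , (λ { refl → int≢end s (dist-s g) i })

    glued-cutting : {s : Tree a b} {o : Tree b a} → Glued G s o →
      Int x s → Int y o → ¬ NonCutting G a b × ¬ NonCutting G b a
    glued-cutting {a} {b} {x} {y} {s = s} {o} g i j =
        (λ { (_ , conn) → sep g i j (conn x y (int-minus g i) (swap (int-minus (glued-swap g) j))) })
      , (λ { (_ , conn) → sep (glued-swap g) j i (conn y x (int-minus (glued-swap g) j) (swap (int-minus g i))) })
      where
      swap : ∀ {a b x} → InMinus G a b x → InMinus G b a x
      swap (p , q , r) = p , r , q
      sep : ∀ {a b x y} {s : Tree a b} {o : Tree b a} → Glued G s o → Int x s → Int y o → ¬ Reach G a b x y
      sep {s = s} g i j r with glued-reach g i r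
      ... | i′ with apart g (inner i′) (inner j)
      ...   | inj₁ refl = int≢start s (dist-s g) i′
      ...   | inj₂ refl = int≢end s (dist-s g) i′

    -- Once the gluing edge is `uv`, triangles on both of its sides would make it cutting. So one
    -- side is a `leaf`, and the other is the whole graph.
    reroot : (s : Tree a b) (o : Tree b a) → Glued G s o → NonCutting G u v → Edge u v s →
      Σ (Tree u v) (IsTree G)
    reroot leaf o g nc base  = mirror o , IsTree-mirror (glued-leaf (glued-swap g))
    reroot leaf o g nc base′ = o , glued-leaf (glued-swap g)
    reroot s@(node _ _ _) leaf g nc base  = s , glued-leaf g
    reroot s@(node _ _ _) leaf g nc base′ = mirror s , IsTree-mirror (glued-leaf g)
    reroot (node _ _ _) (node _ _ _) g nc base  = contradiction nc (proj₁ (glued-cutting g top top))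
    reroot (node _ _ _) (node _ _ _) g nc base′ = contradiction nc (proj₂ (glued-cutting g top top))
    reroot (node c L R) o g nc (inl e) = reroot L _ (glued-left g) nc e
    reroot (node c L R) o g nc (inr e) = reroot R _ (glued-right g) nc e

  glued-root : {G : Graph N} {t : Tree a b} → IsTree G t → Glued G t leaf
  glued-root {t = t} T = record
    { V⇒In = inj₁ ∘ IsTree.V⇒In T
    ; In⇒V = [ IsTree.In⇒V T , (λ { start → IsTree.In⇒V T end ; end → IsTree.In⇒V T start }) ]
    ; A⇒E = inj₁ ∘ IsTree.A⇒E T
    ; E⇒A = [ IsTree.E⇒A T , (λ { base → IsTree.E⇒A T base′ ; base′ → IsTree.E⇒A T base }) ]
    ; dist-s = dist T
    ; dist-o = λ e → ends-distinct t (dist T) (sym e)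
    ; apart = λ { _ start → inj₂ refl ; _ end → inj₁ refl } }

  rooted-at : {G : Graph N} → MaxOuterplanar G → NonCutting G u v → Σ (Tree u v) (IsTree G)
  rooted-at M nc with triangulated M
  ... | _ , _ , t , T , _ = reroot t leaf (glued-root T) nc (IsTree.A⇒E T (proj₁ nc))

  -- Connectivity of cut components

  reach-trans : Reach G a b x y → Reach G a b y z → Reach G a b x z
  reach-trans r (here _) = r
  reach-trans r (step q e i) = step (reach-trans r q) e i

  reach-end : Reach G a b x y → InMinus G a b y
  reach-end (here i) = i
  reach-end (step _ _ i) = i

  reach-sym : (∀ {x y} → Adj G x y → Adj G y x) → Reach G a b x y → Reach G a b y x
  reach-sym s (here i) = here i
  reach-sym s (step r e i) = reach-trans (step (here i) (s e) (reach-end r)) (reach-sym s r)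

  part-reach : {s : Tree a b} → Part G s → Int x s → Reach G a b x y → Int y s
  part-reach S i (here _) = i
  part-reach S i (step r e (_ , z≢a , z≢b)) with edge-inʳ (closed S (part-reach S i r) e)
  ... | inj₁ z≡a = contradiction z≡a z≢a
  ... | inj₂ (inj₁ z≡b) = contradiction z≡b z≢b
  ... | inner j = j

  -- The apexes of a triangle and of the triangle behind one of its sides are adjacent, so
  -- descending the tree traces a walk through interior vertices.
  reach-int : (L : Tree a c) (R : Tree c b) → (∀ {x y} → Edge x y (node c L R) → Adj G x y) →
    (∀ {x} → Int x (node c L R) → InMinus G u v x) →
    Int x (node c L R) → Reach G u v c x
  reach-int L R adj inm top = here (inm top)
  reach-int (node c′ L′ R′) R adj inm (inl i) =
    reach-trans (step (here (inm top)) (adj (inl (inr base′))) (inm (inl top)))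
                (reach-int L′ R′ (adj ∘ inl) (inm ∘ inl) i)
  reach-int L (node c′ L′ R′) adj inm (inr i) =
    reach-trans (step (here (inm top)) (adj (inr (inl base))) (inm (inr top)))
                (reach-int L′ R′ (adj ∘ inr) (inm ∘ inr) i)

  part-irrefl : {s : Tree a b} → Part G s → In x s → ¬ Adj G x x
  part-irrefl {s = s} S i e = edge-irrefl s (dst S) (induced S i i e)

  tree-sym : {t : Tree a b} → IsTree G t → Adj G x y → Adj G y x
  tree-sym T e = E⇒A T (edge-sym (A⇒E T e))

  tree-V : {t : Tree a b} → IsTree G t → Adj G x y → x ∈V G
  tree-V T e = In⇒V T (edge-inˡ (A⇒E T e))

  tree-irrefl : {t : Tree a b} → IsTree G t → ¬ Adj G x x
  tree-irrefl {t = t} T e = edge-irrefl t (dist T) (A⇒E T e)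

  data IsLeaf : Tree a b → Set where
    isLeaf : IsLeaf (leaf {a = a} {b = b})

  leaf-mirror⁻ : (s : Tree a b) → IsLeaf (mirror s) → IsLeaf s
  leaf-mirror⁻ leaf _ = isLeaf

  part-minus : {s : Tree a b} → Part G s → Int x s → x ∈V G → InMinus G a b x
  part-minus {s = s} S i x∈G =
    x∈G , (λ { refl → int≢start s (dst S) i }) , (λ { refl → int≢end s (dst S) i })

  not-in-minus : {s : Tree a b} → ¬ In x s → x ∈V G → InMinus G a b x
  not-in-minus x∉s x∈G = x∈G , (λ { refl → x∉s start }) , (λ { refl → x∉s end })

  module _ {G : Graph N} {u v : Fin N} {t : Tree u v} (T : IsTree G t) where

    part-V : {s : Tree a b} → Part G s → Int x s → x ∈V G
    part-V S top = tree-V T (edge⇒adj S (inl base′))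
    part-V S (inl i) = part-V (part-left S) i
    part-V S (inr i) = part-V (part-right S) i

    part-cutting : {s : Tree a b} → Part G s → x ∈V G → ¬ In x s → Int c s → Cutting G a b
    part-cutting S x∈G x∉s i = edge⇒adj S base , _ , _ ,
      part-minus S i (part-V S i) , not-in-minus {G = G} x∉s x∈G , λ r → x∉s (inner (part-reach S i r))

    noncutting-leaf : {s : Tree a b} → Part G s → x ∈V G → ¬ In x s → NonCutting G a b → IsLeaf s
    noncutting-leaf {s = leaf} _ _ _ _ = isLeaf
    noncutting-leaf {s = node _ _ _} S x∈G x∉s (_ , conn) with part-cutting S x∈G x∉s top
    ... | _ , y , z , iy , iz , sep = contradiction (conn y z iy iz) sep

    noncutting-leaf′ : {s : Tree a b} → Part G s → x ∈V G → ¬ In x s → NonCutting G b a → IsLeaf s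
    noncutting-leaf′ {s = s} S x∈G x∉s nc =
      leaf-mirror⁻ s (noncutting-leaf (part-mirror S) x∈G (x∉s ∘ mirror-in⁻ s) nc)

    -- The edges follow the formula of `CutComponent` literally, so that its last clause holds by
    -- `refl`.
    cutOff : Tree a b → Graph N
    cutOff s = record
      { V = λ x → does (In? x s) ; E = λ x y → E G x y ∧ does (In? x s) ∧ does (In? y s) }

    does⇒ : (s : Tree a b) → does (In? x s) ≡ true → In x s
    does⇒ {x = x} s e with In? x s
    ... | yes i = i
    does⇒ s () | no _

    cutOff-adj : {s : Tree a b} → Adj (cutOff s) x y → Adj G x y × In x s × In y s
    cutOff-adj {x = x} {y} {s} e with E G x y | In? x s | In? y s
    ... | true | yes i | yes j = refl , i , j
    cutOff-adj () | true | yes i | no j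
    cutOff-adj () | true | no i | _
    cutOff-adj () | false | _ | _

    cutOff-tree : {s : Tree a b} → Part G s → IsTree (cutOff s) s
    cutOff-tree {s = s} S = record
      { V⇒In = does⇒ s
      ; In⇒V = dec-true (In? _ s)
      ; A⇒E  = λ {x} {y} e → let e′ , i , j = cutOff-adj {x = x} {y} {s} e in induced S i j e′
      ; E⇒A  = λ e → cong₂ _∧_ (edge⇒adj S e)
                 (cong₂ _∧_ (dec-true (In? _ s) (edge-inˡ e)) (dec-true (In? _ s) (edge-inʳ e)))
      ; dist = dst S }

    cutOff-component : {L : Tree a c} {R : Tree c b} → Part G (node c L R) →
      CutComponent G a b (cutOff (node c L R))
    cutOff-component {a} {c} {b} {L} {R} S = c , inm top , (λ x → mk⇔ (to ∘ does⇒ s) (dec-true (In? x s) ∘ from))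
                                           , λ _ _ → refl
      where
      s = node c L R
      inm : ∀ {x} → Int x s → InMinus G a b x
      inm i = part-minus S i (part-V S i)
      to : In x s → x ≡ a ⊎ x ≡ b ⊎ Reach G a b c x
      to (inj₁ e) = inj₁ e
      to (inj₂ (inj₁ e)) = inj₂ (inj₁ e)
      to (inner i) = inj₂ (inj₂ (reach-int L R (edge⇒adj S) inm i))
      from : x ≡ a ⊎ x ≡ b ⊎ Reach G a b c x → In x s
      from (inj₁ e) = inj₁ e
      from (inj₂ (inj₁ e)) = inj₂ (inj₁ e)
      from (inj₂ (inj₂ r)) = inner (part-reach S top r)

  -- Here `p` is the third vertex of the triangle in front of `ab`; common neighbours of `a` and `b`
  -- other than `p` lie behind the edge.
  Uniq : Graph N → Tree a b → Fin N → Set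
  Uniq {a} {b} G s p = ∀ {z} → Adj G a z → Adj G b z → Int z s ⊎ z ≡ p

  -- All neighbours of `c` lie in the part. One strictly behind `cb` has its own neighbours in `R`,
  -- and `a` is not among them.
  uniq-left : {L : Tree a c} {R : Tree c b} → Part G (node c L R) → Uniq G L b
  uniq-left {a} {c} {b} {L = L} {R} S {z} az cz with edge-inʳ (closed S top cz)
  ... | inj₁ refl = contradiction az (part-irrefl S start)
  ... | inj₂ (inj₁ z≡b) = inj₂ z≡b
  ... | inner top = contradiction cz (part-irrefl S (inner top))
  ... | inner (inl i) = inj₁ i
  ... | inner (inr i) = contradiction
      (edge-inʳ (closed (part-right S) i (edge⇒adj S (edge-sym (induced S start (inner (inr i)) az)))))
      (start∉right L R (dst S))

  uniq-right : {L : Tree a c} {R : Tree c b} → Part G (node c L R) → Uniq G R a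
  uniq-right {R = R} S cz bz with uniq-left (part-mirror S) bz cz
  ... | inj₁ i = inj₁ (mirror-int⁻ R i)
  ... | inj₂ e = inj₂ e

  -- Maximal outerplanar subgraphs and the chords they contain

  Meets : Graph N → Tree a b → Set
  Meets H s = ∃[ x ] (Int x s × x ∈V H)

  meets? : (H : Graph N) (s : Tree a b) → Meets H s ⊎ (∀ {x} → Int x s → ¬ x ∈V H)
  meets? H leaf = inj₂ λ ()
  meets? H (node c L R) with meets? H L | meets? H R | V H c in eq
  ... | inj₁ (x , i , m) | _ | _ = inj₁ (x , inl i , m)
  ... | inj₂ _ | inj₁ (x , i , m) | _ = inj₁ (x , inr i , m)
  ... | inj₂ _ | inj₂ _ | true = inj₁ (c , top , eq)
  ... | inj₂ f | inj₂ g | false = inj₂ λ where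
    top m → contradiction (trans (sym m) eq) λ ()
    (inl i) → f i
    (inr i) → g i

  module Sub {h k : Fin N} {th : Tree h k} (TH : IsTree H th) (H⊂G : ∀ {x y} → Adj H x y → Adj G x y) where

    crossing-edge : {s : Tree a b} → Part G s → Int x s → x ∈V H → y ∈V H → ¬ In y s → Adj H a b
    crossing-edge {a} {b} {x} {y} {s} S i x∈H y∈H y∉s with Adj? H a b
    ... | yes e = e
    ... | no a≁b = contradiction (inner (connected-minus th (dist TH) a b (a≁b ∘ E⇒A TH)
        (λ x → Int x s) step-closed (V⇒In TH x∈H) (V⇒In TH y∈H)
        (λ { refl → int≢start s (dst S) i }) (λ { refl → int≢end s (dst S) i })
        (λ { refl → y∉s start }) (λ { refl → y∉s end }) i)) y∉s
      where
      step-closed : ∀ {x y} → Edge x y th → x ≢ a → x ≢ b → y ≢ a → y ≢ b → Int x s → Int y s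
      step-closed e _ _ y≢a y≢b i with edge-inʳ (closed S i (H⊂G (E⇒A TH e)))
      ... | inj₁ p = contradiction p y≢a
      ... | inj₂ (inj₁ p) = contradiction p y≢b
      ... | inner j = j

    -- If `H` meets the inside of `L`, then `ac` separates that vertex from `b` and `crossing-edge`
    -- applies. Otherwise remove `b` alone: without `ac`, nothing would link `c` and the inside of
    -- `R` to `a`, although `H` stays connected.
    triangleˡ : {L : Tree a c} {R : Tree c b} → Part G (node c L R) → Adj H a b →
      Meets H (node c L R) → Adj H a c
    triangleˡ {a} {c} {b} {L} {R} S ab (x , i , x∈H) with Adj? H a c | meets? H L
    ... | yes e | _ = e
    ... | no _ | inj₁ (z , j , z∈H) =
      crossing-edge (part-left S) j z∈H (tree-V TH (tree-sym TH ab)) (end∉left L R (dst S))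
    ... | no a≁c | inj₂ ∉L = contradiction
        (connected-minus th (dist TH) b b (tree-irrefl TH ∘ E⇒A TH)
          (λ x → x ≡ c ⊎ Int x R) step-closed (V⇒In TH x∈H) (V⇒In TH (tree-V TH ab))
          x≢b x≢b a≢b a≢b (x-in i))
        λ { (inj₁ refl) → ends-distinct L (proj₁ (dst S)) refl
          ; (inj₂ j) → start∉right L R (dst S) (inner j) }
      where
      a≢b : a ≢ b
      a≢b = ends-distinct _ (dst S)
      x≢b : x ≢ b
      x≢b refl = int≢end (node c L R) (dst S) i
      x-in : Int x (node c L R) → x ≡ c ⊎ Int x R
      x-in top = inj₁ refl
      x-in (inl j) = contradiction x∈H (∉L j)
      x-in (inr j) = inj₂ j
      step-closed : ∀ {x y} → Edge x y th → x ≢ b → x ≢ b → y ≢ b → y ≢ b →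
        x ≡ c ⊎ Int x R → y ≡ c ⊎ Int y R
      step-closed e _ _ y≢b _ (inj₂ j) with edge-inʳ (closed (part-right S) j (H⊂G (E⇒A TH e)))
      ... | inj₁ p = inj₁ p
      ... | inj₂ (inj₁ p) = contradiction p y≢b
      ... | inner j′ = inj₂ j′
      step-closed e _ _ y≢b _ (inj₁ refl) with edge-inʳ (closed S top (H⊂G (E⇒A TH e)))
      ... | inj₁ refl = contradiction (tree-sym TH (E⇒A TH e)) a≁c
      ... | inj₂ (inj₁ p) = contradiction p y≢b
      ... | inner top = inj₁ refl
      ... | inner (inl j) = contradiction (tree-V TH (tree-sym TH (E⇒A TH e))) (∉L j)
      ... | inner (inr j) = inj₂ j

    triangle : {L : Tree a c} {R : Tree c b} → Part G (node c L R) → Adj H a b →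
      Meets H (node c L R) → Adj H a c × Adj H b c
    triangle S ab m@(x , i , x∈H) = triangleˡ S ab m
                                  , triangleˡ (part-mirror S) (tree-sym TH ab) (x , mirror-int i , x∈H)

    apex-neighbour : {s : Tree a b} → Part G s → Adj H a b → Meets H s →
      ∃[ z ] (Int z s × Adj H a z × Adj H b z)
    apex-neighbour {s = leaf} S ab (_ , () , _)
    apex-neighbour {s = node c L R} S ab m = c , top , triangle S ab m

  face-through : (G : Graph N) (L : Tree a c) (R : Tree c b) →
    (∀ {x y} → Edge x y (node c L R) → Adj G x y) →
    In x (node c L R) → ∃[ y ] ∃[ z ] IsFace G (x , y , z)
  face-through G L R adj start = _ , _ , adj base , adj (inr base′) , adj (inl base)
  face-through G L R adj end = _ , _ , adj base′ , adj (inl base) , adj (inr base′)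
  face-through G L R adj (inner top) = _ , _ , adj (inl base′) , adj base , adj (inr base)
  face-through G (node _ L′ R′) R adj (inner (inl i)) = face-through G L′ R′ (adj ∘ inl) (inner i)
  face-through G L (node _ L′ R′) adj (inner (inr i)) = face-through G L′ R′ (adj ∘ inr) (inner i)

  triangulated-face : {t : Tree a b} → IsTree G t → ∃[ y ] Int y t → x ∈V G → ∃[ y ] ∃[ z ] IsFace G (x , y , z)
  triangulated-face {G = G} {t = node c L R} T _ x∈G = face-through G L R (E⇒A T) (V⇒In T x∈G)

  -- Faces and dual paths

  ∨-split : ∀ {p q} → p ∨ q ≡ true → p ≡ true ⊎ q ≡ true
  ∨-split {true}  _ = inj₁ refl
  ∨-split {false} e = inj₂ e

  three-of-two : x ≢ y → y ≢ z → x ≢ z → ∀ {p q} → x ≡ p ⊎ x ≡ q → y ≡ p ⊎ y ≡ q → ¬ (z ≡ p ⊎ z ≡ q)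
  three-of-two x≢y y≢z x≢z (inj₁ refl) (inj₁ refl) _ = x≢y refl
  three-of-two x≢y y≢z x≢z (inj₂ refl) (inj₂ refl) _ = x≢y refl
  three-of-two x≢y y≢z x≢z (inj₁ refl) (inj₂ refl) (inj₁ refl) = x≢z refl
  three-of-two x≢y y≢z x≢z (inj₁ refl) (inj₂ refl) (inj₂ refl) = y≢z refl
  three-of-two x≢y y≢z x≢z (inj₂ refl) (inj₁ refl) (inj₁ refl) = y≢z refl
  three-of-two x≢y y≢z x≢z (inj₂ refl) (inj₁ refl) (inj₂ refl) = x≢z refl

  _∈T?_ : ∀ x (t : Tri {N}) → Dec (x ∈T t)
  x ∈T? (a , b , c) with x ≟ a | x ≟ b | x ≟ c
  ... | yes e | _ | _ = yes (inj₁ e)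
  ... | no _ | yes e | _ = yes (inj₂ (inj₁ e))
  ... | no _ | no _ | yes e = yes (inj₂ (inj₂ e))
  ... | no p | no q | no r = no [ p , [ q , r ] ]

  module Dual {h k : Fin N} {th : Tree h k} (TH : IsTree H th)
              {m : ℕ} {f : Fin (suc m) → Tri {N}} (D : DualPath H m f) where

    face-adj : ∀ t → IsFace H t → x ∈T t → y ∈T t → x ≡ y ⊎ Adj H x y
    face-adj (a , b , c) (ab , bc , ac) = λ where
      (inj₁ refl) (inj₁ refl) → inj₁ refl
      (inj₁ refl) (inj₂ (inj₁ refl)) → inj₂ ab
      (inj₁ refl) (inj₂ (inj₂ refl)) → inj₂ ac
      (inj₂ (inj₁ refl)) (inj₁ refl) → inj₂ (tree-sym TH ab)
      (inj₂ (inj₁ refl)) (inj₂ (inj₁ refl)) → inj₁ refl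
      (inj₂ (inj₁ refl)) (inj₂ (inj₂ refl)) → inj₂ bc
      (inj₂ (inj₂ refl)) (inj₁ refl) → inj₂ (tree-sym TH ac)
      (inj₂ (inj₂ refl)) (inj₂ (inj₁ refl)) → inj₂ (tree-sym TH bc)
      (inj₂ (inj₂ refl)) (inj₂ (inj₂ refl)) → inj₁ refl

    face-V : ∀ t → IsFace H t → x ∈T t → x ∈V H
    face-V (a , b , c) (ab , bc , ac) = λ where
      (inj₁ refl) → tree-V TH ab
      (inj₂ (inj₁ refl)) → tree-V TH bc
      (inj₂ (inj₂ refl)) → tree-V TH (tree-sym TH bc)

    adj≢ : Adj H x y → x ≢ y
    adj≢ e refl = tree-irrefl TH e

    face-not-in-two : ∀ t → IsFace H t → ∀ {p q} → ¬ (∀ {x} → x ∈T t → x ≡ p ⊎ x ≡ q)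
    face-not-in-two (a , b , c) (ab , bc , ac) F =
      three-of-two (adj≢ ab) (adj≢ bc) (adj≢ ac) (F (inj₁ refl)) (F (inj₂ (inj₁ refl))) (F (inj₂ (inj₂ refl)))

    idx : ∀ {t} → IsFace H t → Fin (suc m)
    idx F = proj₁ (proj₁ (proj₂ D) _ F)

    idx-same : ∀ {t} (F : IsFace H t) → SameTri t (f (idx F))
    idx-same F = proj₂ (proj₁ (proj₂ D) _ F)

    separate : ∀ {t t′ i j} → SameTri t (f i) → SameTri t′ (f j) → z ∈T t → ¬ z ∈T t′ → i ≢ j
    separate S S′ z∈t z∉t′ refl = z∉t′ (Equivalence.from (S′ _) (Equivalence.to (S _) z∈t))

    share⇒next : ∀ {t t′ i j} → SameTri t (f i) → SameTri t′ (f j) → ShareEdge t t′ →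
      z ∈T t → ¬ z ∈T t′ → Next i j
    share⇒next S S′ (x , y , x≢y , p , q , r , s) z∈t z∉t′ =
      Equivalence.to (proj₂ (proj₂ (proj₂ D)) _ _ (separate S S′ z∈t z∉t′))
        (x , y , x≢y , Equivalence.to (S x) p , Equivalence.to (S y) q
                     , Equivalence.to (S′ x) r , Equivalence.to (S′ y) s)

    next⇒share : ∀ {i j} → Next i j → ShareEdge (f i) (f j)
    next⇒share n = Equivalence.from (proj₂ (proj₂ (proj₂ D)) _ _ (next≢ n)) n

    same⇒≡ : ∀ {i j} → SameTri (f i) (f j) → i ≡ j
    same⇒≡ = proj₁ (proj₂ (proj₂ D)) _ _

    -- Every vertex of such a face besides `a` and `b` is a common neighbour of the two, hence `p`;
    -- both faces are `abp`.
    same-third : ∀ {i j} → a ≢ b → a ∈T f i → b ∈T f i → a ∈T f j → b ∈T f j →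
      (∀ {z} → Adj H a z → Adj H b z → z ≡ p) → i ≡ j
    same-third {a} {b} {p} {i} {j} a≢b ai bi aj bj third = same⇒≡ λ x → mk⇔
        (λ q → into j aj bj (out i ai bi q)) (λ q → into i ai bi (out j aj bj q))
      where
      out : ∀ i → a ∈T f i → b ∈T f i → x ∈T f i → x ≡ a ⊎ x ≡ b ⊎ x ≡ p
      out i ai bi xi with face-adj (f i) (proj₁ D i) ai xi | face-adj (f i) (proj₁ D i) bi xi
      ... | inj₁ refl | _ = inj₁ refl
      ... | _ | inj₁ refl = inj₂ (inj₁ refl)
      ... | inj₂ e | inj₂ e′ = inj₂ (inj₂ (third e e′))
      p∈ : ∀ i → a ∈T f i → b ∈T f i → p ∈T f i
      p∈ i ai bi with p ∈T? f i
      ... | yes q = q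
      ... | no p∉ = ⊥-elim (face-not-in-two (f i) (proj₁ D i) λ q →
                [ inj₁ , [ inj₂ , (λ { refl → contradiction q p∉ }) ] ] (out i ai bi q))
      into : ∀ i → a ∈T f i → b ∈T f i → x ≡ a ⊎ x ≡ b ⊎ x ≡ p → x ∈T f i
      into i ai bi (inj₁ refl) = ai
      into i ai bi (inj₂ (inj₁ refl)) = bi
      into i ai bi (inj₂ (inj₂ refl)) = p∈ i ai bi

    -- Here `a` and `b` may be adjacent, so `connected-minus` does not help. Since they have at most
    -- one common neighbour in `H`, consecutive faces never share `ab`; some vertex of the shared
    -- edge survives and carries reachability on. Within a face the surviving vertices are adjacent.
    reach-in-faces : ∀ {U : Graph N} {a b r} → (∀ {x y} → Adj H x y → Adj U x y) →
      (∀ {x} → x ∈V H → x ∈V U) → (∀ {x} → x ∈V H → ∃[ y ] ∃[ z ] IsFace H (x , y , z)) →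
      a ≢ b → (∀ {z} → Adj H a z → Adj H b z → z ≡ p) →
      r ∈V H → r ≢ a → r ≢ b → x ∈V H → x ≢ a → x ≢ b → Reach U a b r x
    reach-in-faces {p} {x} {U} {a} {b} {r} E⊆ V⊆ cover a≢b third r∈H r≢a r≢b x∈H x≢a x≢b =
      good x≢a x≢b (next-chain Q next-good (proj₁ (at r∈H)) (proj₁ (at x∈H))
        (spread (proj₂ (at r∈H)) r≢a r≢b (here (V⊆ r∈H , r≢a , r≢b))) (proj₂ (at x∈H)))
      where
      Good : Fin N → Set
      Good x = x ≡ a ⊎ x ≡ b ⊎ Reach U a b r x
      good : ∀ {x} → x ≢ a → x ≢ b → Good x → Reach U a b r x
      good x≢a _ (inj₁ e) = contradiction e x≢a
      good _ x≢b (inj₂ (inj₁ e)) = contradiction e x≢b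
      good _ _ (inj₂ (inj₂ R)) = R
      Q : Fin (suc m) → Set
      Q i = ∀ {x} → x ∈T f i → Good x
      at : ∀ {x} → x ∈V H → ∃[ i ] x ∈T f i
      at x∈H with cover x∈H
      ... | y , z , F = idx F , Equivalence.to (idx-same F _) (inj₁ refl)
      spread : ∀ {i y} → y ∈T f i → y ≢ a → y ≢ b → Reach U a b r y → Q i
      spread {i} y∈ y≢a y≢b R {x} x∈ with x ≟ a | x ≟ b
      ... | yes e | _ = inj₁ e
      ... | no _ | yes e = inj₂ (inj₁ e)
      ... | no x≢a | no x≢b with face-adj (f i) (proj₁ D i) y∈ x∈
      ...   | inj₁ refl = inj₂ (inj₂ R)
      ...   | inj₂ e = inj₂ (inj₂ (step R (E⊆ e) (V⊆ (face-V (f i) (proj₁ D i) x∈) , x≢a , x≢b)))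
      next-good : ∀ {i j} → Next i j → Q i → Q j
      next-good {i} {j} n q with next⇒share n
      ... | x , y , x≢y , xi , yi , xj , yj with x ≟ a | x ≟ b | y ≟ a | y ≟ b
      ...   | no x≢a | no x≢b | _ | _ = spread xj x≢a x≢b (good x≢a x≢b (q xi))
      ...   | _ | _ | no y≢a | no y≢b = spread yj y≢a y≢b (good y≢a y≢b (q yi))
      ...   | yes refl | _ | yes refl | _ = contradiction refl x≢y
      ...   | _ | yes refl | _ | yes refl = contradiction refl x≢y
      ...   | yes refl | _ | _ | yes refl = contradiction (same-third a≢b xi yi xj yj third) (next≢ n)
      ...   | _ | yes refl | yes refl | _ = contradiction (same-third a≢b yi xi yj xj third) (next≢ n)

    module _ {L : Tree a c} {R : Tree c b} (S : Part G (node c L R))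
             (ab : Adj H a b) (ac : Adj H a c) (bc : Adj H b c) where
      private
        s = node c L R
        F₀ : IsFace H (a , b , c)
        F₀ = ab , bc , ac
        a≢b = ends-distinct s (dst S)
        a≢c = ends-distinct L (proj₁ (dst S))
        c≢b = ends-distinct R (proj₁ (proj₂ (dst S)))

      -- Along a dual path a face cannot have neighbours across all three of its edges.
      no-branch : ¬ In p s → Adj H a p → Adj H b p →
        ∃[ z ] (Int z L × Adj H a z × Adj H c z) → ∃[ z ] (Int z R × Adj H c z × Adj H b z) → ⊥
      no-branch {p} p∉s ap bp (x , i , ax , cx) (y , j , cy , by) =
        [ separate (idx-same Fp) (idx-same Fl) (inj₂ (inj₂ refl)) p∉l
        , [ separate (idx-same Fp) (idx-same Fr) (inj₂ (inj₂ refl)) p∉r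
          , separate (idx-same Fl) (idx-same Fr) (inj₂ (inj₂ refl)) x∉r ] ]
        (next-three
          (share⇒next (idx-same F₀) (idx-same Fp)
            (a , b , a≢b , inj₁ refl , inj₂ (inj₁ refl) , inj₁ refl , inj₂ (inj₁ refl)) (inj₂ (inj₂ refl)) c∉p)
          (share⇒next (idx-same F₀) (idx-same Fl)
            (a , c , a≢c , inj₁ refl , inj₂ (inj₂ refl) , inj₁ refl , inj₂ (inj₁ refl)) (inj₂ (inj₁ refl)) b∉l)
          (share⇒next (idx-same F₀) (idx-same Fr)
            (c , b , c≢b , inj₂ (inj₂ refl) , inj₂ (inj₁ refl) , inj₁ refl , inj₂ (inj₁ refl)) (inj₁ refl) a∉r))
        where
        Fp : IsFace H (a , b , p)
        Fp = ab , bp , ap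
        Fl : IsFace H (a , c , x)
        Fl = ac , cx , ax
        Fr : IsFace H (c , b , y)
        Fr = tree-sym TH bc , by , cy
        c∉p : ¬ c ∈T (a , b , p)
        c∉p (inj₁ e) = a≢c (sym e)
        c∉p (inj₂ (inj₁ e)) = c≢b e
        c∉p (inj₂ (inj₂ refl)) = p∉s (inner top)
        b∉l : ¬ b ∈T (a , c , x)
        b∉l (inj₁ e) = a≢b (sym e)
        b∉l (inj₂ (inj₁ e)) = c≢b (sym e)
        b∉l (inj₂ (inj₂ refl)) = end∉left L R (dst S) (inner i)
        a∉r : ¬ a ∈T (c , b , y)
        a∉r (inj₁ e) = a≢c e
        a∉r (inj₂ (inj₁ e)) = a≢b e
        a∉r (inj₂ (inj₂ refl)) = start∉right L R (dst S) (inner j)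
        p∉l : ¬ p ∈T (a , c , x)
        p∉l (inj₁ refl) = p∉s start
        p∉l (inj₂ (inj₁ refl)) = p∉s (inner top)
        p∉l (inj₂ (inj₂ refl)) = p∉s (inner (inl i))
        p∉r : ¬ p ∈T (c , b , y)
        p∉r (inj₁ refl) = p∉s (inner top)
        p∉r (inj₂ (inj₁ refl)) = p∉s end
        p∉r (inj₂ (inj₂ refl)) = p∉s (inner (inr j))
        x∉r : ¬ x ∈T (c , b , y)
        x∉r (inj₁ refl) = int≢end L (proj₁ (dst S)) i
        x∉r (inj₂ (inj₁ refl)) = end∉left L R (dst S) (inner i)
        x∉r (inj₂ (inj₂ refl)) = intL∉R L R (dst S) i (inner j)

      -- A neighbouring face containing `c` has all its vertices among `a`, `b`, `c`, and one
      -- avoiding `c` can share only `ab`; both contain `a` and `b`. At an inner position, the two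
      -- neighbours would thus share an edge with each other.
      last-face : (∀ {x y} → Adj H x y → Adj G x y) →
        (∀ {x} → Int x L → ¬ x ∈V H) → (∀ {x} → Int x R → ¬ x ∈V H) →
        ∃[ i ] (SameTri (a , b , c) (f i) × (i ≡ zero ⊎ i ≡ fromℕ m))
      last-face H⊂G ∉L ∉R with end-or-inner (idx F₀)
      ... | inj₁ e = _ , idx-same F₀ , inj₁ e
      ... | inj₂ (inj₁ e) = _ , idx-same F₀ , inj₂ e
      ... | inj₂ (inj₂ (j , k , nj , nk , j≢k , j≁k)) = ⊥-elim (j≁k
          (Equivalence.to (proj₂ (proj₂ (proj₂ D)) j k j≢k)
            (a , b , a≢b , proj₁ (beyond nj) , proj₂ (beyond nj) , proj₁ (beyond nk) , proj₂ (beyond nk))))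
        where
        around-c : ∀ {j} → c ∈T f j → x ∈T f j → x ≡ a ⊎ x ≡ b ⊎ x ≡ c
        around-c {j = j} c∈ x∈ with face-adj (f j) (proj₁ D j) c∈ x∈
        ... | inj₁ refl = inj₂ (inj₂ refl)
        ... | inj₂ e with edge-inʳ (closed S top (H⊂G e))
        ...   | inj₁ p = inj₁ p
        ...   | inj₂ (inj₁ p) = inj₂ (inj₁ p)
        ...   | inner top = inj₂ (inj₂ refl)
        ...   | inner (inl i) = contradiction (face-V (f j) (proj₁ D j) x∈) (∉L i)
        ...   | inner (inr i) = contradiction (face-V (f j) (proj₁ D j) x∈) (∉R i)
        beyond : ∀ {j} → Next (idx F₀) j → a ∈T f j × b ∈T f j
        beyond {j} n with c ∈T? f j
        ... | yes c∈ = only-a , only-b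
          where
          only-a : a ∈T f j
          only-a with a ∈T? f j
          ... | yes q = q
          ... | no a∉ = ⊥-elim (face-not-in-two (f j) (proj₁ D j)
            λ q → [ (λ { refl → contradiction q a∉ }) , id ] (around-c c∈ q))
          only-b : b ∈T f j
          only-b with b ∈T? f j
          ... | yes q = q
          ... | no b∉ = ⊥-elim (face-not-in-two (f j) (proj₁ D j)
            λ q → [ inj₁ , [ (λ { refl → contradiction q b∉ }) , inj₂ ] ] (around-c c∈ q))
        ... | no c∉ with next⇒share n
        ...   | x , y , x≢y , xi , yi , xj , yj
          with Equivalence.from (idx-same F₀ x) xi | Equivalence.from (idx-same F₀ y) yi
        ...     | inj₁ refl | inj₁ refl = contradiction refl x≢y
        ...     | inj₁ refl | inj₂ (inj₁ refl) = xj , yj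
        ...     | inj₂ (inj₁ refl) | inj₁ refl = yj , xj
        ...     | inj₂ (inj₁ refl) | inj₂ (inj₁ refl) = contradiction refl x≢y
        ...     | inj₂ (inj₂ refl) | _ = contradiction xj c∉
        ...     | _ | inj₂ (inj₂ refl) = contradiction yj c∉

  -- From bonnets to the recursive decomposition

  module InBonnet {u v : Fin N} {t : Tree u v} (T : IsTree G t) (B : Bonnet G u v) {d : ℕ}
    (hyp : ∀ a b → Anchor G (U B) a b → ∀ S → CutComponent G a b S → ¬ Adj S u v →
           HasBonnetSystem d S a b)
    (IH : ∀ {a b S} {s : Tree a b} → IsTree S s → HasBonnetSystem d S a b → BS d s) where

    open Bonnet B using (P; F₁; F₂; ab-nc; cd-nc; P-sub; P-conn; u∈P; v∈P; common∈P; fan₁; fan₂; nbrs)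

    P⊂G : ∀ {x y} → Adj P x y → Adj G x y
    P⊂G = proj₂ P-sub _ _

    private
      P-tri : Triangulated P
      P-tri = triangulated (proj₁ P-conn)

      TP = proj₁ (proj₂ (proj₂ (proj₂ P-tri)))

      P-path = proj₂ (proj₂ (proj₂ (proj₂ P-conn)))

      DP = proj₁ (proj₂ (proj₂ P-path))

      module PSub = Sub {G = G} TP P⊂G
      module PDual = Dual TP DP

      u∈G : u ∈V G
      u∈G = In⇒V T start

    P⊂U : Adj P x y → Adj (U B) x y
    P⊂U e rewrite e = refl

    F₁⊂U : Adj F₁ x y → Adj (U B) x y
    F₁⊂U {x} {y} e rewrite e = ∨-zeroʳ (E P x y)

    F₂⊂U : Adj F₂ x y → Adj (U B) x y
    F₂⊂U {x} {y} e rewrite e | ∨-zeroʳ (E F₁ x y) = ∨-zeroʳ (E P x y)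

    U-V : x ∈V U B → x ∈V P ⊎ x ∈V F₁ ⊎ x ∈V F₂
    U-V e = Sum.map₂ ∨-split (∨-split e)

    U-P : x ∈V P → x ∈V U B
    U-P e rewrite e = refl

    U-F₁ : x ∈V F₁ → x ∈V U B
    U-F₁ {x} e rewrite e = ∨-zeroʳ (V P x)

    U-F₂ : x ∈V F₂ → x ∈V U B
    U-F₂ {x} e rewrite e | ∨-zeroʳ (V F₁ x) = ∨-zeroʳ (V P x)

    fan-sym : ∀ {F w} → FanAt G P F w → Adj F x y → Adj F y x
    fan-sym {x} {y} (inj₁ (_ , none)) e = contradiction (trans (sym e) (none x y)) λ ()
    fan-sym (inj₂ ((((s , _) , _) , _) , _)) e = s _ _ e

    U-sym : Adj (U B) x y → Adj (U B) y x
    U-sym e with ∨-split e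
    ... | inj₁ e = P⊂U (tree-sym TP e)
    ... | inj₂ e with ∨-split e
    ...   | inj₁ e = F₁⊂U (fan-sym fan₁ e)
    ...   | inj₂ e = F₂⊂U (fan-sym fan₂ e)

    fan-near : ∀ {F w} → FanAt G P F w → x ∈V F → x ≡ w ⊎ Adj G w x
    fan-near {x} (inj₁ (none , _)) x∈F = contradiction (trans (sym x∈F) (none x)) λ ()
    fan-near (inj₂ (_ , _ , near , _)) = near _

    fan-avoids : ∀ {F w} {s : Tree a b} → FanAt G P F w → Part G s → ¬ In w s → Int x s → ¬ x ∈V F
    fan-avoids fan S w∉s i x∈F with fan-near fan x∈F
    ... | inj₁ refl = w∉s (inner i)
    ... | inj₂ e = w∉s (edge-inʳ (closed S i (tree-sym T e)))

    -- The cut component at an edge ab of the bonnet that the ribbon does not enter hangs at an anchor.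
    module _ {s : Tree a b} (S : Part G s) (uniq : Uniq G s p) (u∉s : ¬ In u s) (v∉s : ¬ In v s)
             (∉P : ∀ {x} → Int x s → ¬ x ∈V P) where
      private
        u≢a : u ≢ a
        u≢a refl = u∉s start
        u≢b : u ≢ b
        u≢b refl = u∉s end
        v≢a : v ≢ a
        v≢a refl = v∉s start
        v≢b : v ≢ b
        v≢b refl = v∉s end

        third : (∀ {x y} → Adj H x y → Adj G x y) → (∀ {x} → Int x s → ¬ x ∈V H) →
          {h k : Fin N} {th : Tree h k} → IsTree H th → Adj H a z → Adj H b z → z ≡ p
        third H⊂G ∉H TH az bz with uniq (H⊂G az) (H⊂G bz)
        ... | inj₁ i = contradiction (tree-V TH (tree-sym TH az)) (∉H i)
        ... | inj₂ e = e

        fan-reach : ∀ {F w} → FanAt G P F w → (∀ {x y} → Adj F x y → Adj (U B) x y) →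
          (∀ {x} → x ∈V F → x ∈V U B) → ¬ In w s → x ∈V F → x ≢ a → x ≢ b → Reach (U B) a b w x
        fan-reach {x} (inj₁ (none , _)) _ _ _ x∈F = contradiction (trans (sym x∈F) (none x)) λ ()
        fan-reach fan@(inj₂ ((M , m , f , D) , F-sub , near , _ , _ , wx , _)) F⊂U U-F w∉s x∈F x≢a x≢b =
          Dual.reach-in-faces TF D F⊂U U-F (triangulated-face TF (proj₂ (proj₂ (proj₂ (proj₂ M-tri)))))
            (ends-distinct s (dst S)) (third (proj₂ F-sub _ _) (fan-avoids fan S w∉s) TF)
            (tree-V TF wx) (λ { refl → w∉s start }) (λ { refl → w∉s end }) x∈F x≢a x≢b
          where
          M-tri = triangulated M
          TF = proj₁ (proj₂ (proj₂ (proj₂ M-tri)))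

        P-reach : ∀ {r} → r ∈V P → r ≢ a → r ≢ b → x ∈V P → x ≢ a → x ≢ b → Reach (U B) a b r x
        P-reach = PDual.reach-in-faces P⊂U U-P
          (triangulated-face TP (proj₂ (proj₂ (proj₂ (proj₂ P-tri)))))
          (ends-distinct s (dst S)) (third P⊂G ∉P TP)

        reach-u : InMinus (U B) a b x → Reach (U B) a b u x
        reach-u (x∈U , x≢a , x≢b) with U-V x∈U
        ... | inj₁ x∈P = P-reach u∈P u≢a u≢b x∈P x≢a x≢b
        ... | inj₂ (inj₁ x∈F) = fan-reach fan₁ F₁⊂U U-F₁ u∉s x∈F x≢a x≢b
        -- Through the ribbon from `u` to `v`, where the second fan is attached.
        ... | inj₂ (inj₂ x∈F) = reach-trans (P-reach u∈P u≢a u≢b v∈P v≢a v≢b)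
                                  (fan-reach fan₂ F₂⊂U U-F₂ v∉s x∈F x≢a x≢b)

      -- Behind a proper subtree `ab` is cutting in `G`, its apex and `u` being on different sides.
      -- In the bonnet it is not: every vertex left is reachable from `u`. So `ab` is an
      -- anchor-edge. The case split is on a copy of `s`, which is a parameter here.
      hang : Adj (U B) a b → BS d s
      hang = go s refl
        where
        go : ∀ s′ → s′ ≡ s → Adj (U B) a b → BS d s′
        go leaf _ _ = leaf
        go (node c L R) refl ab = IH (cutOff-tree T S)
          (hyp a b (ab , part-cutting T S u∈G u∉s top , not-cutting) (cutOff T s)
            (cutOff-component T S) λ e → u∉s (proj₁ (proj₂ (cutOff-adj T {s = s} e))))
          where
          not-cutting : ¬ Cutting (U B) a b
          not-cutting (_ , x , y , ix , iy , sep) = sep (reach-trans (reach-sym U-sym (reach-u ix)) (reach-u iy))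

    -- The edge cannot be `ab`, which has `c` behind it and `u` in front. So it is one of the other
    -- two sides, and nothing lies behind that one.
    end-edge : {L : Tree a c} {R : Tree c b} → Part G (node c L R) → ¬ In u (node c L R) →
      NonCutting G x y → EdgeOf x y (a , b , c) → IsLeaf L ⊎ IsLeaf R
    end-edge S u∉s nc (inj₁ refl , inj₁ refl) = contradiction (proj₁ nc) (part-irrefl S start)
    end-edge S u∉s nc (inj₂ (inj₁ refl) , inj₂ (inj₁ refl)) = contradiction (proj₁ nc) (part-irrefl S end)
    end-edge S u∉s nc (inj₂ (inj₂ refl) , inj₂ (inj₂ refl)) = contradiction (proj₁ nc) (part-irrefl S (inner top))
    end-edge S u∉s nc (inj₁ refl , inj₂ (inj₁ refl)) with noncutting-leaf T S u∈G u∉s nc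
    ... | ()
    end-edge S u∉s nc (inj₂ (inj₁ refl) , inj₁ refl) with noncutting-leaf′ T S u∈G u∉s nc
    ... | ()
    end-edge S u∉s nc (inj₁ refl , inj₂ (inj₂ refl)) =
      inj₁ (noncutting-leaf T (part-left S) u∈G (u∉s ∘ in-left) nc)
    end-edge S u∉s nc (inj₂ (inj₂ refl) , inj₁ refl) =
      inj₁ (noncutting-leaf′ T (part-left S) u∈G (u∉s ∘ in-left) nc)
    end-edge S u∉s nc (inj₂ (inj₂ refl) , inj₂ (inj₁ refl)) =
      inj₂ (noncutting-leaf T (part-right S) u∈G (u∉s ∘ in-right) nc)
    end-edge S u∉s nc (inj₂ (inj₁ refl) , inj₂ (inj₂ refl)) =
      inj₂ (noncutting-leaf′ T (part-right S) u∈G (u∉s ∘ in-right) nc)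

    transfer : ∀ {t t′ : Tri {N}} → SameTri t t′ → EdgeOf x y t′ → EdgeOf x y t
    transfer e (p , q) = Equivalence.from (e _) p , Equivalence.from (e _) q

    -- The face `abp` precedes, so the ribbon continues behind at most one side of `abc`, and the
    -- other side carries a hanging subtree. If it continues behind neither, `abc` is its last face
    -- and holds a non-cutting edge of `G`; that `leaf` closes the ribbon.
    ribbon : (s : Tree a b) → Part G s → Uniq G s p → ¬ In p s → ¬ In u s → ¬ In v s →
      Adj P a b → Adj P a p → Adj P b p → Meets P s → Rib d s
    ribbon leaf _ _ _ _ _ _ _ _ _ = leaf
    ribbon (node c L R) S uniq p∉s u∉s v∉s ab ap bp m with PSub.triangle S ab m | meets? P L | meets? P R
    ... | ac , bc | inj₁ mL | inj₁ mR = ⊥-elim (PDual.no-branch S ab ac bc p∉s ap bp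
            (PSub.apex-neighbour (part-left S) ac mL) (PSub.apex-neighbour (part-right S) (tree-sym TP bc) mR))
    ... | ac , bc | inj₁ mL | inj₂ ∉R = left
            (ribbon L (part-left S) (uniq-left S) (end∉left L R (dst S)) (u∉s ∘ in-left) (v∉s ∘ in-left)
              ac ab (tree-sym TP bc) mL)
            (hang (part-right S) (uniq-right S) (u∉s ∘ in-right) (v∉s ∘ in-right) ∉R (P⊂U (tree-sym TP bc)))
    ... | ac , bc | inj₂ ∉L | inj₁ mR = right
            (hang (part-left S) (uniq-left S) (u∉s ∘ in-left) (v∉s ∘ in-left) ∉L (P⊂U ac))
            (ribbon R (part-right S) (uniq-right S) (start∉right L R (dst S)) (u∉s ∘ in-right) (v∉s ∘ in-right)
              (tree-sym TP bc) (tree-sym TP ac) (tree-sym TP ab) mR)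
    ... | ac , bc | inj₂ ∉L | inj₂ ∉R = finish leaf-edge
      where
      leaf-edge : IsLeaf L ⊎ IsLeaf R
      leaf-edge with PDual.last-face S ab ac bc P⊂G ∉L ∉R
      ... | i , same , inj₁ refl = end-edge S u∉s ab-nc (transfer same (proj₁ (proj₂ (proj₂ (proj₂ P-path)))))
      ... | i , same , inj₂ refl = end-edge S u∉s cd-nc (transfer same (proj₂ (proj₂ (proj₂ (proj₂ P-path)))))
      finish : IsLeaf L ⊎ IsLeaf R → Rib d (node c L R)
      finish (inj₁ isLeaf) = left leaf
        (hang (part-right S) (uniq-right S) (u∉s ∘ in-right) (v∉s ∘ in-right) ∉R (P⊂U (tree-sym TP bc)))
      finish (inj₂ isLeaf) = right
        (hang (part-left S) (uniq-left S) (u∉s ∘ in-left) (v∉s ∘ in-left) ∉L (P⊂U ac)) leaf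

    -- u₁ is either end of the cap, F and F′ are the fans at u₁ and at the other end v₁.
    module Side {u₁ v₁ : Fin N} {F F′ : Graph N} (fan : FanAt G P F u₁) (fan′ : FanAt G P F′ v₁)
      (F⊂U : ∀ {x y} → Adj F x y → Adj (U B) x y)
      (near : ∀ {w} → Adj G u₁ w → w ∈V P ⊎ w ∈V F ⊎ w ∈V F′)
      (hang₁ : ∀ {a b p} {s : Tree a b} → Part G s → Uniq G s p → ¬ In u₁ s → ¬ In v₁ s →
        (∀ {x} → Int x s → ¬ x ∈V P) → Adj (U B) a b → BS d s)
      (ribbon₁ : ∀ {a b p} (s : Tree a b) → Part G s → Uniq G s p → ¬ In p s → ¬ In u₁ s → ¬ In v₁ s →
        Adj P a b → Adj P a p → Adj P b p → Meets P s → Rib d s) where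

      -- The bonnet contains all neighbours of `u₁`. The ribbon is excluded, and the other fan stays
      -- near `v₁`, which is outside `s`.
      neighbour-in-fan : {s : Tree a b} → Part G s → ¬ In v₁ s → (∀ {x} → Int x s → ¬ x ∈V P) →
        Int x s → Adj G u₁ x → x ∈V F
      neighbour-in-fan S v∉s ∉P i ux with near ux
      ... | inj₁ x∈P = contradiction x∈P (∉P i)
      ... | inj₂ (inj₁ x∈F) = x∈F
      ... | inj₂ (inj₂ x∈F′) = contradiction x∈F′ (fan-avoids fan′ S v∉s i)

      module _ {h k : Fin N} {th : Tree h k} (TF : IsTree F th) (F⊂G : ∀ {x y} → Adj F x y → Adj G x y) where
        private module FSub = Sub {G = G} TF F⊂G

        -- Each apex `c` is a neighbour of `u₁` that the ribbon misses, so it lies in the fan, and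
        -- with it both edges joining it to `u₁` and `e`.
        spine : {e : Fin N} (s : Tree u₁ e) → Part G s → ¬ In v₁ s → (∀ {x} → Int x s → ¬ x ∈V P) →
          Adj F u₁ e → Fan d s
        spine leaf _ _ _ _ = leaf
        spine (node c L R) S v∉s ∉P ue =
          let uc , ec = FSub.triangle S ue
                (c , top , neighbour-in-fan S v∉s ∉P top (edge⇒adj S (inl base)))
          in node (spine L (part-left S) (v∉s ∘ in-left) (∉P ∘ inl) uc)
                  (hang₁ (part-right S) (uniq-right S) (start∉right L R (dst S)) (v∉s ∘ in-right)
                    (∉P ∘ inr) (F⊂U (tree-sym TF ec)))

        -- The fan shares an edge `u₁x` with the ribbon. If `x` is not `e`, it lies outside `s`
        -- while `y` lies inside, so the fan must contain the separating chord `u₁e`.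
        fan-edge : {e x : Fin N} {s : Tree u₁ e} → Part G s → (∀ {x} → Int x s → ¬ x ∈V P) → Meets F s →
          Adj P u₁ e → Adj P u₁ x → Adj F u₁ x →
          (∀ a b → Adj P a b → Adj F a b → SameEdge a b u₁ x) → Adj F u₁ e
        fan-edge {e} {x} {s} S ∉P (y , i , y∈F) ue ux ux′ common with x ≟ e
        ... | yes refl = ux′
        ... | no x≢e with FSub.crossing-edge S i y∈F (tree-V TF (tree-sym TF ux′)) x∉s
          where
          x∉s : ¬ In x s
          x∉s (inj₁ refl) = tree-irrefl TP ux
          x∉s (inj₂ (inj₁ e)) = x≢e e
          x∉s (inner i) = ∉P i (tree-V TP (tree-sym TP ux))
        ...   | ue′ = ue′

      whole-fan : {e : Fin N} (s : Tree u₁ e) → Part G s → ¬ In v₁ s → (∀ {x} → Int x s → ¬ x ∈V P) →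
        Adj P u₁ e → Fan d s
      whole-fan leaf _ _ _ _ = leaf
      whole-fan s@(node c L R) S v∉s ∉P ue = go fan
        where
        c∈F : c ∈V F
        c∈F = neighbour-in-fan S v∉s ∉P top (edge⇒adj S (inl base))
        go : FanAt G P F u₁ → Fan d s
        go (inj₁ (none , _)) = contradiction (trans (sym c∈F) (none c)) λ ()
        go (inj₂ ((M , _) , F-sub , _ , x , ux , ux′ , common)) =
          spine TF F⊂G s S v∉s ∉P (fan-edge TF F⊂G S ∉P (c , top , c∈F) ue ux ux′ common)
          where
          TF = proj₁ (proj₂ (proj₂ (proj₂ (triangulated M))))
          F⊂G : ∀ {x y} → Adj F x y → Adj G x y
          F⊂G = proj₂ F-sub _ _

      -- The ribbon enters at most one of the parts behind `u₁c` and `ce`. Once it enters the part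
      -- behind `ce`, it has left the neighbours of `u₁`, and those remaining belong to the fan.
      -- Until then the part behind `ce` hangs.
      side : {e : Fin N} (s : Tree u₁ e) → Part G s → Uniq G s p → ¬ In p s → ¬ In v₁ s →
        Adj P u₁ e → Adj P u₁ p → Adj P e p → LP d s
      side leaf _ _ _ _ _ _ _ = leaf
      side s@(node c L R) S uniq p∉s v∉s ue up ep with meets? P s
      ... | inj₂ ∉P = Fan⇒LP (whole-fan s S v∉s ∉P ue)
      ... | inj₁ m with PSub.triangle S ue m | meets? P L | meets? P R
      ...   | uc , ec | inj₁ mL | inj₁ mR = ⊥-elim (PDual.no-branch S ue uc ec p∉s up ep
              (PSub.apex-neighbour (part-left S) uc mL) (PSub.apex-neighbour (part-right S) (tree-sym TP ec) mR))
      ...   | uc , ec | inj₂ ∉L | inj₁ mR = turn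
              (whole-fan L (part-left S) (v∉s ∘ in-left) ∉L uc)
              (ribbon₁ R (part-right S) (uniq-right S) (start∉right L R (dst S)) (start∉right L R (dst S))
                (v∉s ∘ in-right) (tree-sym TP ec) (tree-sym TP uc) (tree-sym TP ue) mR)
      ...   | uc , ec | _ | inj₂ ∉R = next
              (side L (part-left S) (uniq-left S) (end∉left L R (dst S)) (v∉s ∘ in-left)
                uc ue (tree-sym TP ec))
              (hang₁ (part-right S) (uniq-right S) (start∉right L R (dst S)) (v∉s ∘ in-right) ∉R
                (P⊂U (tree-sym TP ec)))

  bonnet⇒BS : ∀ d {G : Graph N} (t : Tree u v) → IsTree G t → HasBonnetSystem d G u v → BS d t
  bonnet⇒BS (suc d) leaf T _ = leaf
  bonnet⇒BS {u} {v} (suc d) {G} t@(node w L R) T (B , hyp) =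
    -- The ribbon contains the triangle `uvw`, so the third vertex in front is `v` for the side at
    -- `u` and `u` for the side at `v`.
    node (Side₁.side L (part-left S) (uniq-left S) (end∉left L R (dst S)) (end∉left L R (dst S))
           uw uv (tree-sym TP vw))
         (Side₂.side (mirror R) (part-left S′) (uniq-left S′) u∉R u∉R vw (tree-sym TP uv) (tree-sym TP uw))
    where
    open InBonnet T B hyp (λ {_} {_} {_} {s} T′ h → bonnet⇒BS d s T′ h)
    open Bonnet B using (P; F₁; F₂; P-conn; u∈P; v∈P; common∈P; fan₁; fan₂; nbrs)
    S : Part G t
    S = IsTree⇒Part T
    S′ : Part G (mirror t)
    S′ = part-mirror S
    TP = proj₁ (proj₂ (proj₂ (proj₂ (triangulated (proj₁ P-conn)))))
    u∉R : ¬ In u (mirror R)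
    u∉R = start∉right L R (dst S) ∘ mirror-in⁻ R
    w∈P : w ∈V P
    w∈P = common∈P w (E⇒A T (inl base)) (E⇒A T (inr base′))
    -- Removing w from the ribbon leaves uv as the only possible link between its two sides.
    uv : Adj P u v
    uv with Adj? P u v
    ... | yes e = e
    ... | no u≁v = contradiction
        (connected-minus _ (dist TP) w w (tree-irrefl TP ∘ E⇒A TP) (λ x → x ≡ u ⊎ Int x L) stays
          (V⇒In TP u∈P) (V⇒In TP v∈P) u≢w u≢w v≢w v≢w (inj₁ refl))
        λ { (inj₁ refl) → ends-distinct t (dist T) refl
          ; (inj₂ i) → end∉left L R (dist T) (inner i) }
      where
      u≢w = ends-distinct L (proj₁ (dist T))
      v≢w = λ e → ends-distinct R (proj₁ (proj₂ (dist T))) (sym e)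
      stays : ∀ {x y} → Edge x y _ → x ≢ w → x ≢ w → y ≢ w → y ≢ w → x ≡ u ⊎ Int x L → y ≡ u ⊎ Int y L
      stays e _ _ y≢w _ (inj₂ i) with edge-inʳ (closed (part-left S) i (P⊂G (E⇒A TP e)))
      ... | inj₁ p = inj₁ p
      ... | inj₂ (inj₁ p) = contradiction p y≢w
      ... | inner j = inj₂ j
      stays e _ _ y≢w _ (inj₁ refl) with A⇒E T (P⊂G (E⇒A TP e))
      ... | base = contradiction (E⇒A TP e) u≁v
      ... | base′ = inj₁ refl
      ... | inr e′ = contradiction (edge-inˡ e′) (start∉right L R (dist T))
      ... | inl e′ with edge-inʳ e′
      ...   | inj₁ p = inj₁ p
      ...   | inj₂ (inj₁ p) = contradiction p y≢w
      ...   | inner j = inj₂ j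
    triangle = Sub.triangle {G = G} TP P⊂G S uv (w , top , w∈P)
    uw = proj₁ triangle
    vw = proj₂ triangle
    near : ∀ {x} → Adj G u x ⊎ Adj G v x → x ∈V P ⊎ x ∈V F₁ ⊎ x ∈V F₂
    near e = U-V (nbrs _ e)
    module Side₁ = Side fan₁ fan₂ F₁⊂U (near ∘ inj₁) hang ribbon
    module Side₂ = Side fan₂ fan₁ F₂⊂U (Sum.map₂ Sum.swap ∘ near ∘ inj₂)
      (λ S q v∉ u∉ → hang S q u∉ v∉) (λ s S q p∉ v∉ u∉ → ribbon s S q p∉ u∉ v∉)

theorem1 : ∀ {N : ℕ} (G : Graph N) → MaxOuterplanar G →
    ∀ (d : ℕ) (u v : Fin N) → NonCutting G u v → HasBonnetSystem d G u v →
    Σ (FlatVisRep G) λ R → IsPlanarFlatVis R × HeightAtMost R (2 * d + 1)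
theorem1 G M d u v nc S =
  let t , T = rooted-at M nc in BS⇒drawing T d (bonnet⇒BS d t T S)
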